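{- Let $G$ be a directed graph with generic non-negative dart weights, cellularly embedded on an orientable surface of genus $g\ge 1$, and let $f$ be a face of $G$. As the source point $s$ moves once around the boundary of $f$, each dart of $G$ pivots into (or out of) the shortest-path tree rooted at $s$ at most $O(g)$ times.
   Context: Surfaces are compact connected 2-manifolds. The directed edges of $G$ are called darts; $u\to v$ is a dart with tail $u$ and head $v$. Whenever $G$ contains a dart it also contains its reversal; the edge $uv$ is the pair $\{u\to v,v\to u\}$, and the two darts may have different finite non-negative weights $w$. An embedding of $G$ is an embedding of its underlying undirected graph; it is cellular if every face is an open disk. Moving the source. The source point $s$ moves continuously along the facial walk bounding $f$, edge by edge (an edge occurring twice in the facial walk is traversed twice). While $s$ moves from $u$ to $v$ along an edge $uv$, its position is given by $\lambda\in[0,1]$ increasing from $0$ to $1$: the edge $uv$ is subdivided by $s$ with weights $w_\lambda(u\to s)=\lambda w(u\to v)$, $w_\lambda(s\to v)=(1-\lambda)w(u\to v)$, $w_\lambda(s\to u)=\lambda w(v\to u)$, $w_\lambda(v\to s)=(1-\lambda)w(v\to u)$, and all other weights are unchanged. Let $T_\lambda$ be the shortest-path tree rooted at $s$, $\mathrm{dist}_\lambda$ the distance from $s$, and $\mathrm{slack}_\lambda(x\to y)=\mathrm{dist}_\lambda(x)+w_\lambda(x\to y)-\mathrm{dist}_\lambda(y)$. At a critical value of $\lambda$ the slack of some dart $y\to z$ not in $T_\lambda$ (with $z\neq s$) decreases to zero, so that it is just about to become tense (have negative slack); then $y\to z$ pivots into the tree, replacing the tree dart $x\to z$ currently entering $z$,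 which pivots out. The weights are generic if all vertex-to-vertex shortest paths in $G$ are unique and exactly one dart becomes tense at each critical value. -}

module Defs where

open import Level using (Level; _⊔_) renaming (suc to lsuc)
open import Algebra.Bundles using (CommutativeRing)
open import Data.Bool using (Bool; not; _∨_; if_then_else_)
import Data.Bool.Properties as Bool
open import Data.Fin using (Fin)
import Data.Fin.Properties as Fin
open import Data.List using (List; []; _∷_; map; foldr; length)
open import Data.List.Relation.Unary.All using (All)
import Data.List.Relation.Unary.Unique.Propositional as Propositional
import Data.List.Relation.Unary.Unique.Setoid as UniqueSetoid
open import Data.Nat using (ℕ)
import Data.Nat as ℕ
open import Data.Nat.GeneralisedArithmetic using (iterate)
open import Data.Product using (∃-syntax; _×_; _,_; proj₁; proj₂)
import Data.Product.Properties as Product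
open import Data.Product.Relation.Binary.Pointwise.NonDependent using (×-setoid)
open import Data.Sum using (_⊎_)
open import Function using (_∘_)
open import Function.Bundles using (_↔_; _⇔_; module Inverse)
open import Function.Definitions using (StrictlySurjective)
open import Relation.Binary using (Rel; DecidableEquality; IsStrictTotalOrder)
open import Relation.Binary.PropositionalEquality using (_≡_)
import Relation.Binary.PropositionalEquality as ≡
open import Relation.Nullary using (¬_; does)

-- The weights and the parameter λ range over an arbitrary ordered field; the
-- real numbers are the intended instance.

record OrderedField (c ℓ₁ ℓ₂ : Level) : Set (lsuc (c ⊔ ℓ₁ ⊔ ℓ₂)) where
  field
    commutativeRing : CommutativeRing c ℓ₁

  open CommutativeRing commutativeRing public

  infix 4 _<_ _≤_

  field
    _<_                : Rel Carrier ℓ₂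
    isStrictTotalOrder : IsStrictTotalOrder _≈_ _<_
    0<1                : 0# < 1#
    +-monoʳ-<          : ∀ x {y z} → y < z → x + y < x + z
    *-pos              : ∀ {x y} → 0# < x → 0# < y → 0# < x * y
    inverse            : ∀ x → ¬ (x ≈ 0#) → ∃[ y ] x * y ≈ 1#

  _≤_ : Rel Carrier (ℓ₁ ⊔ ℓ₂)
  x ≤ y = x < y ⊎ x ≈ y

module Walks {V D : Set} (tail head : D → V) where

  IsWalk : V → List D → V → Set
  IsWalk u []       v = u ≡ v
  IsWalk u (x ∷ xs) v = tail x ≡ u × IsWalk (head x) xs v

  IsSimple : V → List D → Set
  IsSimple u xs = Propositional.Unique (u ∷ map head xs)

  module Weighted {c ℓ₁ ℓ₂} (K : OrderedField c ℓ₁ ℓ₂)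
                  (w : D → OrderedField.Carrier K) where
    open OrderedField K

    weight : List D → Carrier
    weight = foldr (λ x r → w x + r) 0#

    IsShortestWalk : V → List D → V → Set (ℓ₁ ⊔ ℓ₂)
    IsShortestWalk u xs v =
      IsWalk u xs v × (∀ ys → IsWalk u ys v → weight xs ≤ weight ys)

    -- As weights are non-negative, a simple walk that is shortest among the
    -- simple ones is also shortest among all walks.
    IsShortestPath : V → List D → V → Set (ℓ₁ ⊔ ℓ₂)
    IsShortestPath u xs v = IsSimple u xs × IsShortestWalk u xs v

    IsDist : V → V → Carrier → Set (ℓ₁ ⊔ ℓ₂)
    IsDist u v δ = ∃[ xs ] IsShortestWalk u xs v × weight xs ≈ δ

    IsSlack : V → D → Carrier → Set (ℓ₁ ⊔ ℓ₂ ⊔ c)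
    IsSlack r x σ = ∃[ δ ] ∃[ δ′ ]
      IsDist r (tail x) δ × IsDist r (head x) δ′ × σ ≈ (δ + w x) - δ′

-- A cellular embedding of a finite connected graph (loops and parallel edges
-- allowed) on the closed orientable surface of genus g, given by its rotation
-- system: `rotation` sends each dart to the next dart, in the cyclic order
-- fixed by the orientation, among those with the same tail.  The faces are
-- the orbits of `next`, which traces the facial walks, and the genus is
-- determined by Euler's formula V - E + F = 2 - 2g.

record CellularEmbedding (g : ℕ) : Set where
  field
    #V #E #F : ℕ

  Vertex : Set
  Vertex = Fin #V

  Dart : Set
  Dart = Fin #E × Bool

  Face : Set
  Face = Fin #F

  rev : Dart → Dart
  rev x = proj₁ x , not (proj₂ x)

  _≟_ : DecidableEquality Dart
  _≟_ = Product.≡-dec Fin._≟_ Bool._≟_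

  field
    tail     : Dart → Vertex
    rotation : Dart ↔ Dart
    face     : Dart → Face

  head : Dart → Vertex
  head = tail ∘ rev

  next : Dart → Dart
  next = Inverse.to rotation ∘ rev

  open Walks tail head public

  field
    tail-surjective : StrictlySurjective _≡_ tail
    tail-orbits     : ∀ x y →
      tail x ≡ tail y ⇔ (∃[ k ] iterate (Inverse.to rotation) x k ≡ y)
    face-surjective : StrictlySurjective _≡_ face
    face-orbits     : ∀ x y → face x ≡ face y ⇔ (∃[ k ] iterate next x k ≡ y)
    connected       : ∀ u v → ∃[ xs ] IsWalk u xs v
    euler           : #V ℕ.+ #F ℕ.+ 2 ℕ.* g ≡ #E ℕ.+ 2

module MovingSource {c ℓ₁ ℓ₂} (K : OrderedField c ℓ₁ ℓ₂)
                    {g : ℕ} (G : CellularEmbedding g)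
                    (w : CellularEmbedding.Dart G → OrderedField.Carrier K) where
  open OrderedField K
  open CellularEmbedding G
  open Weighted K w

  NonNegative : Set (ℓ₁ ⊔ ℓ₂)
  NonNegative = ∀ x → 0# ≤ w x

  data SubVertex : Set where
    source : SubVertex
    vertex : Vertex → SubVertex

  -- The darts of G with the edge of e = u → v subdivided by s: `end x` is the
  -- part of x that enters head x, so that it is x itself if x is not on the
  -- edge, while end e is s → v and end (rev e) is s → u; `start` and
  -- `startʳ` are u → s and v → s.
  data SubDart : Set where
    end          : Dart → SubDart
    start startʳ : SubDart

  module _ (e : Dart) where

    subTail : SubDart → SubVertex
    subTail (end x) =
      if does (x ≟ e) ∨ does (x ≟ rev e) then source else vertex (tail x)
    subTail start  = vertex (tail e)
    subTail startʳ = vertex (head e)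

    subHead : SubDart → SubVertex
    subHead (end x) = vertex (head x)
    subHead start   = source
    subHead startʳ  = source

    subWeight : Carrier → SubDart → Carrier
    subWeight t (end x) =
      if does (x ≟ e) then (1# - t) * w x
      else if does (x ≟ rev e) then t * w x
      else w x
    subWeight t start  = t * w e
    subWeight t startʳ = (1# - t) * w (rev e)

    module Sub = Walks subTail subHead
    module At (t : Carrier) = Sub.Weighted K (subWeight t)

    Slack : Carrier → Dart → Carrier → Set (ℓ₁ ⊔ ℓ₂ ⊔ c)
    Slack t x = At.IsSlack t source (end x)

    -- A spanning tree rooted at s is given by the dart of G through which it
    -- enters each vertex of G.
    record IsShortestPathTree (t : Carrier) (T : Vertex → Dart)
           : Set (ℓ₁ ⊔ ℓ₂) where
      field
        enters   : ∀ v → head (T v) ≡ v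
        shortest : ∀ v → ∃[ xs ] At.IsShortestWalk t source xs (vertex v)
                               × All (λ x → ∃[ u ] x ≡ end (T u)) xs

    -- At λ = t, the dart y pivots into the tree and x pivots out.  Here T is
    -- the shortest-path tree just before t (and, by continuity, still a
    -- shortest-path tree at t).  For t = 1 the source lies at head e, so that
    -- z ≠ s has to be required explicitly.
    record Pivot (t : Carrier) (y x : Dart) : Set (ℓ₁ ⊔ ℓ₂ ⊔ c) where
      field
        t≤1         : t ≤ 1#
        z≠s         : ¬ (t ≈ 1# × head y ≡ head e)
        r           : Carrier
        0≤r         : 0# ≤ r
        r<t         : r < t
        T           : Vertex → Dart
        isTree      : ∀ q → r ≤ q → q ≤ t → IsShortestPathTree q T
        nontree     : ¬ (T (head y) ≡ y)
        replaced    : T (head y) ≡ x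
        decreasing  : ∀ {q q′ σ σ′} → r ≤ q → q < q′ → q′ ≤ t →
                      Slack q y σ → Slack q′ y σ′ → σ′ < σ
        vanishes    : Slack t y 0#

    PivotsIn PivotsOut : Carrier → Dart → Set (ℓ₁ ⊔ ℓ₂ ⊔ c)
    PivotsIn  t y = ∃[ x ] Pivot t y x
    PivotsOut t x = ∃[ y ] Pivot t y x

  -- At every critical value some dart becomes tense by definition, so only
  -- its uniqueness has to be demanded.
  record Generic (f : Face) : Set (ℓ₁ ⊔ ℓ₂ ⊔ c) where
    field
      uniquePaths : ∀ {u v xs ys} →
        IsShortestPath u xs v → IsShortestPath u ys v → xs ≡ ys
      uniquePivot : ∀ {e t y y′} → face e ≡ f →
        PivotsIn e t y → PivotsIn e t y′ → y ≡ y′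

  -- A position (e , t) is the point λ = t of the edge of e, traversed in the
  -- direction of e.  The facial walk around f traverses the darts of f once
  -- each.
  Position : Set c
  Position = Dart × Carrier

  open UniqueSetoid (×-setoid (≡.setoid Dart) setoid)
    using (Unique)

  HappensAtMost : ℕ → Face → (Dart → Carrier → Set (ℓ₁ ⊔ ℓ₂ ⊔ c)) →
                  Set (ℓ₁ ⊔ ℓ₂ ⊔ c)
  HappensAtMost n f P = (ps : List Position) → Unique ps →
    All (λ (e , t) → face e ≡ f × P e t) ps → length ps ℕ.≤ n

{-# OPTIONS --safe #-}
module Submission where

-- Fix the head z of the dart under consideration.  Unique shortest paths to z
-- form a tree, and the dart pivots while s runs along u → v exactly if one of
-- u and v lies in the branch of the tree behind the dart and the other does
-- not, up to the single case of the edge of the dart itself; the position of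
-- s is then determined by equating the lengths of the two paths.  So the
-- pivots are counted by the edges on which the facial walk enters (or leaves)
-- the branch.  Colour the vertices by membership in it; both colours are
-- spanned by trees, so such crossings x₀, …, xₙ on one face give closed walks
-- that follow the face from x₀ to xᵢ and return within the first colour.
-- Over F₂ these n cycles and all but one face boundary are independent: in a
-- vanishing combination the coefficients of the two sides of an edge agree at
-- every vertex of the second colour, hence after each of the crossings, and
-- comparing them before and after xᵢ isolates the coefficient of its cycle.
-- All of them are orthogonal to the V - 1 independent vertex stars, whence
-- (V - 1) + (F - 1) + n ≤ E, which is n ≤ 2g by Euler's formula.

open import Defs

open import Level using (_⊔_)
open import Algebra.Bundles using (CommutativeRing)
import Algebra.Properties.AbelianGroup as AbelianGroup
import Algebra.Properties.CommutativeSemigroup as CommutativeSemigroup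
open import Data.Bool using (Bool; true; false; not; _∧_; _xor_; if_then_else_)
import Data.Bool.Properties as Bool
open import Data.Fin using (Fin; zero; suc; punchIn; punchOut; splitAt; join)
import Data.Fin.Properties as Fin
open import Data.List using (List; []; _∷_; _++_; _∷ʳ_; map; foldr; filter; length; lookup)
import Data.List.Properties as List
open import Data.List.Membership.Propositional using (_∈_; _∉_)
open import Data.List.Membership.Propositional.Properties
  using (∈-lookup; ∈-map⁺; ∈-++⁺ˡ; ∈-++⁺ʳ; ∈-++⁻)
open import Data.List.Relation.Unary.All as All using (All; []; _∷_)
import Data.List.Relation.Unary.All.Properties as All
open import Data.List.Relation.Unary.AllPairs using ([]; _∷_)
open import Data.List.Relation.Unary.Any using (here; there; any?)
open import Data.List.Relation.Unary.Unique.Propositional using (Unique)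
import Data.List.Relation.Unary.Unique.Propositional.Properties as Unique
import Data.List.Relation.Unary.Unique.Setoid as UniqueSetoid
open import Data.Nat as ℕ using (ℕ; zero; suc; z≤n; s≤s)
open import Data.Nat.GeneralisedArithmetic using (iterate)
import Data.Nat.Properties as ℕ
open import Data.Product using (∃; ∃-syntax; _×_; _,_; proj₁; proj₂)
open import Data.Product.Relation.Binary.Pointwise.NonDependent using (×-setoid)
open import Data.Sum as Sum using (_⊎_; inj₁; inj₂; [_,_]′)
open import Function using (_∘_; case_of_; _⇔_; mk⇔; Inverse; Equivalence)
open import Relation.Binary using (IsStrictTotalOrder; StrictPartialOrder; tri<; tri≈; tri>)
open import Relation.Binary.Construct.Closure.ReflexiveTransitive
  using (Star; ε; _◅_; _◅◅_; reverse)
import Relation.Binary.Construct.StrictToNonStrict as StrictToNonStrict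
open import Relation.Binary.PropositionalEquality as ≡ using (_≡_; _≢_)
import Relation.Binary.Reasoning.StrictPartialOrder as StrictReasoning
open import Relation.Nullary using (¬_; Dec; yes; no; does; contradiction; ¬?)
open import Relation.Nullary.Decidable using (dec-true; dec-false; does-⇔; _⊎-dec_)

-- Linear algebra over F₂: independence, orthogonality and elimination.

module BinaryLinearAlgebra where
  open ≡ using (refl; sym; trans; cong; cong₂)
  open ≡.≡-Reasoning
  open import Algebra.Properties.Semiring.Sum
    (CommutativeRing.semiring Bool.xor-∧-commutativeRing)

  sum-false : ∀ {n} (h : Fin n → Bool) → (∀ i → h i ≡ false) → sum h ≡ false
  sum-false {n} h h≡0 = trans (sum-cong-≗ h≡0) (sum-replicate-zero n)

  Independent : ∀ {p n} → (Fin p → Fin n → Bool) → Set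
  Independent {p} A =
    ∀ (c : Fin p → Bool) → (∀ k → ∑[ i < p ] (c i ∧ A i k) ≡ false) → ∀ i → c i ≡ false

  Orthogonal : ∀ {n} → (Fin n → Bool) → (Fin n → Bool) → Set
  Orthogonal {n} a b = ∑[ k < n ] (a k ∧ b k) ≡ false

  independent-head≢0 : ∀ {p n} (A : Fin (suc p) → Fin n → Bool) →
                       Independent A → ∃ λ k → A zero k ≡ true
  independent-head≢0 {p} {n} A indep with Fin.any? (λ k → A zero k Bool.≟ true)
  ... | yes found = found
  ... | no none = contradiction (indep unit vanishes zero) λ ()
    where
    unit : Fin (suc p) → Bool
    unit zero    = true
    unit (suc _) = false

    vanishes : ∀ k → ∑[ i < suc p ] (unit i ∧ A i k) ≡ false
    vanishes k = cong₂ _xor_ (Bool.¬-not (none ∘ (k ,_))) (sum-replicate-zero p)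

  -- One step of Gaussian elimination: row zero is added to each later row that has a nonzero entry
  -- in column `k`. This clears the column when row zero itself is nonzero there.
  clear : ∀ {p n} → (Fin (suc p) → Fin n → Bool) → Fin n → Fin p → Fin n → Bool
  clear A k i j = (A (suc i) k ∧ A zero j) xor A (suc i) j

  clear-pivot : ∀ {p n} (A : Fin (suc p) → Fin n → Bool) {k} → A zero k ≡ true →
                ∀ i → clear A k i k ≡ false
  clear-pivot A {k} A₀ₖ i = begin
    (A (suc i) k ∧ A zero k) xor A (suc i) k ≡⟨ cong (λ a → (A (suc i) k ∧ a) xor A (suc i) k) A₀ₖ ⟩
    (A (suc i) k ∧ true) xor A (suc i) k     ≡⟨ cong (_xor A (suc i) k) (Bool.∧-identityʳ (A (suc i) k)) ⟩
    A (suc i) k xor A (suc i) k              ≡⟨ Bool.xor-same (A (suc i) k) ⟩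
    false                                    ∎

  removed : ∀ {n} (h : Fin (suc n) → Bool) k → h k ≡ false →
            sum h ≡ sum (h ∘ punchIn k)
  removed h k hₖ = trans (sum-remove {i = k} h) (cong (_xor sum (h ∘ punchIn k)) hₖ)

  -- A combination of cleared rows is a combination of the original rows in which row zero receives
  -- the coefficient `s`. Column `k` may be deleted, as every cleared row vanishes there.
  clear-independent : ∀ {p n} (A : Fin (suc p) → Fin (suc n) → Bool) {k} →
                      A zero k ≡ true → Independent A →
                      Independent (λ i j → clear A k i (punchIn k j))
  clear-independent {p} {n} A {k} A₀ₖ indep c vanishes i = indep c⁺ vanishes⁺ (suc i)
    where
    s : Bool
    s = ∑[ i < p ] (c i ∧ A (suc i) k)

    c⁺ : Fin (suc p) → Bool
    c⁺ zero    = s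
    c⁺ (suc i) = c i

    expand : ∀ j → ∑[ i < suc p ] (c⁺ i ∧ A i j) ≡ ∑[ i < p ] (c i ∧ clear A k i j)
    expand j = begin
      s ∧ A zero j xor ∑[ i < p ] (c i ∧ A (suc i) j)
        ≡⟨ cong (_xor _) (*-distribʳ-sum (A zero j) (λ i → c i ∧ A (suc i) k)) ⟩
      ∑[ i < p ] ((c i ∧ A (suc i) k) ∧ A zero j) xor ∑[ i < p ] (c i ∧ A (suc i) j)
        ≡⟨ ∑-distrib-+ {p} (λ i → (c i ∧ A (suc i) k) ∧ A zero j) (λ i → c i ∧ A (suc i) j) ⟨
      ∑[ i < p ] ((c i ∧ A (suc i) k) ∧ A zero j xor c i ∧ A (suc i) j)
        ≡⟨ sum-cong-≗ {p} (λ i → cong (_xor c i ∧ A (suc i) j) (Bool.∧-assoc (c i) _ _)) ⟩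
      ∑[ i < p ] (c i ∧ (A (suc i) k ∧ A zero j) xor c i ∧ A (suc i) j)
        ≡⟨ sum-cong-≗ {p} (λ i → sym (Bool.∧-distribˡ-xor (c i) (A (suc i) k ∧ A zero j) (A (suc i) j))) ⟩
      ∑[ i < p ] (c i ∧ clear A k i j) ∎

    vanishes⁺ : ∀ j → ∑[ i < suc p ] (c⁺ i ∧ A i j) ≡ false
    vanishes⁺ j with k Fin.≟ j
    ... | yes refl = trans (expand j) (sum-false {p} _ λ i →
                       trans (cong (c i ∧_) (clear-pivot A A₀ₖ i)) (Bool.∧-zeroʳ (c i)))
    ... | no k≢j = begin
      ∑[ i < suc p ] (c⁺ i ∧ A i j)    ≡⟨ expand j ⟩
      ∑[ i < p ] (c i ∧ clear A k i j) ≡⟨ cong (λ l → ∑[ i < p ] (c i ∧ clear A k i l)) (Fin.punchIn-punchOut k≢j) ⟨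
      _                                ≡⟨ vanishes (punchOut k≢j) ⟩
      false                            ∎

  -- A vector orthogonal to `a` is determined by its coordinates other than k.
  delete-independent : ∀ {m n} (B : Fin m → Fin (suc n) → Bool) {k}
                       (a : Fin (suc n) → Bool) → a k ≡ true →
                       (∀ j → Orthogonal a (B j)) → Independent B →
                       Independent (λ j → B j ∘ punchIn k)
  delete-independent {m} {n} B {k} a aₖ orth indep c vanishes = indep c vanishes⁺
    where
    coordinate : ∀ j → B j k ≡ ∑[ l < n ] (a (punchIn k l) ∧ B j (punchIn k l))
    coordinate j = begin
      B j k                                       ≡⟨ cong (_∧ B j k) aₖ ⟨
      a k ∧ B j k                                 ≡⟨ Bool.xor-identityʳ _ ⟨
      a k ∧ B j k xor false                       ≡⟨ cong ((a k ∧ B j k) xor_) (Bool.xor-same rest) ⟨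
      a k ∧ B j k xor (rest xor rest)             ≡⟨ Bool.xor-assoc (a k ∧ B j k) rest rest ⟨
      (a k ∧ B j k xor rest) xor rest             ≡⟨ cong (_xor rest) (sum-remove {i = k} (λ l → a l ∧ B j l)) ⟨
      ∑[ l < suc n ] (a l ∧ B j l) xor rest       ≡⟨ cong (_xor rest) (orth j) ⟩
      rest                                        ∎
      where rest = ∑[ l < n ] (a (punchIn k l) ∧ B j (punchIn k l))

    swap : ∀ x y z → x ∧ (y ∧ z) ≡ y ∧ (x ∧ z)
    swap false y z = sym (Bool.∧-zeroʳ y)
    swap true  y z = refl

    vanishes⁺ : ∀ l → ∑[ j < m ] (c j ∧ B j l) ≡ false
    vanishes⁺ l with k Fin.≟ l
    ... | no k≢l = trans
      (cong (λ l → ∑[ j < m ] (c j ∧ B j l)) (sym (Fin.punchIn-punchOut k≢l)))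
      (vanishes (punchOut k≢l))
    ... | yes refl = begin
      ∑[ j < m ] (c j ∧ B j k)
        ≡⟨ sum-cong-≗ {m} (λ j → trans (cong (c j ∧_) (coordinate j)) (*-distribˡ-sum {n} (c j) _)) ⟩
      ∑[ j < m ] ∑[ i < n ] (c j ∧ (a (punchIn k i) ∧ B j (punchIn k i)))
        ≡⟨ ∑-comm {m} {n} (λ j i → c j ∧ (a (punchIn k i) ∧ B j (punchIn k i))) ⟩
      ∑[ i < n ] ∑[ j < m ] (c j ∧ (a (punchIn k i) ∧ B j (punchIn k i)))
        ≡⟨ sum-cong-≗ {n} (λ i → trans (sum-cong-≗ {m} λ j → swap (c j) (a (punchIn k i)) _)
             (sym (*-distribˡ-sum {m} (a (punchIn k i)) _))) ⟩
      ∑[ i < n ] (a (punchIn k i) ∧ ∑[ j < m ] (c j ∧ B j (punchIn k i)))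
        ≡⟨ sum-false {n} _ (λ i → trans (cong (a (punchIn k i) ∧_) (vanishes i)) (Bool.∧-zeroʳ _)) ⟩
      false ∎

  -- Each cleared row is a combination of rows of `A`, hence orthogonal to `b`, and its coordinate
  -- `k` contributes nothing to the product.
  clear-orthogonal : ∀ {p n} (A : Fin (suc p) → Fin (suc n) → Bool) {k} →
                     A zero k ≡ true → (b : Fin (suc n) → Bool) →
                     (∀ i → Orthogonal (A i) b) →
                     ∀ i → Orthogonal (λ j → clear A k i (punchIn k j)) (b ∘ punchIn k)
  clear-orthogonal {p} {n} A {k} A₀ₖ b orth i = begin
    ∑[ j < n ] (clear A k i (punchIn k j) ∧ b (punchIn k j))
      ≡⟨ removed (λ j → clear A k i j ∧ b j) k (cong (_∧ b k) (clear-pivot A A₀ₖ i)) ⟨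
    ∑[ j < suc n ] (clear A k i j ∧ b j)
      ≡⟨ sum-cong-≗ {suc n} (λ j → trans
           (Bool.∧-distribʳ-xor (b j) (A (suc i) k ∧ A zero j) (A (suc i) j))
           (cong (_xor A (suc i) j ∧ b j) (Bool.∧-assoc (A (suc i) k) _ _))) ⟩
    ∑[ j < suc n ] (A (suc i) k ∧ (A zero j ∧ b j) xor A (suc i) j ∧ b j)
      ≡⟨ ∑-distrib-+ {suc n} (λ j → A (suc i) k ∧ (A zero j ∧ b j)) (λ j → A (suc i) j ∧ b j) ⟩
    ∑[ j < suc n ] (A (suc i) k ∧ (A zero j ∧ b j)) xor ∑[ j < suc n ] (A (suc i) j ∧ b j)
      ≡⟨ cong₂ _xor_ (sym (*-distribˡ-sum {suc n} (A (suc i) k) (λ j → A zero j ∧ b j))) (orth (suc i)) ⟩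
    A (suc i) k ∧ ∑[ j < suc n ] (A zero j ∧ b j) xor false
      ≡⟨ Bool.xor-identityʳ _ ⟩
    A (suc i) k ∧ ∑[ j < suc n ] (A zero j ∧ b j)
      ≡⟨ cong (A (suc i) k ∧_) (orth zero) ⟩
    A (suc i) k ∧ false
      ≡⟨ Bool.∧-zeroʳ _ ⟩
    false ∎

  -- Induction on the dimension, deleting a pivot coordinate of the first row of `A`. Elimination
  -- costs `A` one row, while `B` keeps all of its rows, because orthogonality to that row recovers
  -- the deleted coordinate. Once `A` is empty, elimination continues in `B` alone.
  independent-orthogonal-bound : ∀ {p m n}
    (A : Fin p → Fin n → Bool) (B : Fin m → Fin n → Bool) →
    Independent A → Independent B → (∀ i j → Orthogonal (A i) (B j)) →
    p ℕ.+ m ℕ.≤ n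
  independent-orthogonal-bound {zero} {zero} A B indA indB orth = z≤n
  independent-orthogonal-bound {zero} {suc m} {zero} A B indA indB orth =
    case independent-head≢0 B indB of λ ()
  independent-orthogonal-bound {zero} {suc m} {suc n} A B indA indB orth =
    let k , B₀ₖ = independent-head≢0 B indB in
    s≤s (independent-orthogonal-bound {zero} {m} {n} (λ ()) (λ j → clear B k j ∘ punchIn k)
          (λ _ _ ()) (clear-independent B B₀ₖ indB) (λ ()))
  independent-orthogonal-bound {suc p} {m} {zero} A B indA indB orth =
    case independent-head≢0 A indA of λ ()
  independent-orthogonal-bound {suc p} {m} {suc n} A B indA indB orth =
    let k , A₀ₖ = independent-head≢0 A indA in
    s≤s (independent-orthogonal-bound {p} {m} {n} (λ i → clear A k i ∘ punchIn k) (λ j → B j ∘ punchIn k)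
          (clear-independent A A₀ₖ indA)
          (delete-independent B (A zero) A₀ₖ (orth zero) indB)
          (λ i j → clear-orthogonal A A₀ₖ (B j) (λ i → orth i j) i))

  xor-interchange : ∀ a b c d → (a xor b) xor (c xor d) ≡ (a xor c) xor (b xor d)
  xor-interchange false b c d = begin
    b xor (c xor d) ≡⟨ Bool.xor-assoc b c d ⟨
    (b xor c) xor d ≡⟨ cong (_xor d) (Bool.xor-comm b c) ⟩
    (c xor b) xor d ≡⟨ Bool.xor-assoc c b d ⟩
    c xor (b xor d) ∎
  xor-interchange true b c d = begin
    not b xor (c xor d)   ≡⟨ Bool.not-distribˡ-xor b (c xor d) ⟨
    not (b xor (c xor d)) ≡⟨ cong not (xor-interchange false b c d) ⟩
    not (c xor (b xor d)) ≡⟨ Bool.not-distribˡ-xor c (b xor d) ⟩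
    not c xor (b xor d)   ∎

  xor-false⇒≡ : ∀ {a b} → a xor b ≡ false → a ≡ b
  xor-false⇒≡ {false} {false} _ = refl
  xor-false⇒≡ {true}  {true}  _ = refl

  ≡⇒xor-false : ∀ {a b} → a ≡ b → a xor b ≡ false
  ≡⇒xor-false {a} refl = Bool.xor-same a

  sum-∧-xor : ∀ {n} (c p q : Fin n → Bool) →
              ∑[ i < n ] (c i ∧ (p i xor q i)) ≡
              ∑[ i < n ] (c i ∧ p i) xor ∑[ i < n ] (c i ∧ q i)
  sum-∧-xor {n} c p q = trans
    (sum-cong-≗ {n} λ i → Bool.∧-distribˡ-xor (c i) (p i) (q i))
    (∑-distrib-+ {n} (λ i → c i ∧ p i) (λ i → c i ∧ q i))

  sum-δ : ∀ {n} (h : Fin n → Bool) a → ∑[ j < n ] (h j ∧ does (a Fin.≟ j)) ≡ h a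
  sum-δ {suc n} h a = begin
    ∑[ j < suc n ] (h j ∧ does (a Fin.≟ j))
      ≡⟨ sum-remove {i = a} (λ j → h j ∧ does (a Fin.≟ j)) ⟩
    h a ∧ does (a Fin.≟ a) xor ∑[ j < n ] (h (punchIn a j) ∧ does (a Fin.≟ punchIn a j))
      ≡⟨ cong₂ _xor_
           (trans (cong (h a ∧_) (dec-true (a Fin.≟ a) refl)) (Bool.∧-identityʳ (h a)))
           (sum-false {n} _ λ j → trans
             (cong (h (punchIn a j) ∧_) (dec-false (a Fin.≟ punchIn a j) (Fin.punchInᵢ≢i a j ∘ sym)))
             (Bool.∧-zeroʳ _)) ⟩
    h a xor false
      ≡⟨ Bool.xor-identityʳ (h a) ⟩
    h a ∎

  sum-⊎ : ∀ m {n} (h : Fin m ⊎ Fin n → Bool) →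
          ∑[ i < m ℕ.+ n ] h (splitAt m i) ≡
          ∑[ i < m ] h (inj₁ i) xor ∑[ i < n ] h (inj₂ i)
  sum-⊎ zero    h = refl
  sum-⊎ (suc m) h = trans
    (cong (h (inj₁ zero) xor_) (sum-⊎ m (h ∘ Sum.map₁ suc)))
    (sym (Bool.xor-assoc (h (inj₁ zero)) _ _))

  lookup-injective : ∀ {a} {A : Set a} {xs : List A} → Unique xs →
                     ∀ {i j} → lookup xs i ≡ lookup xs j → i ≡ j
  lookup-injective {xs = _ ∷ xs} (x≢ ∷ u) {zero}  {zero}  _  = refl
  lookup-injective {xs = _ ∷ xs} (x≢ ∷ u) {zero}  {suc j} eq =
    contradiction eq (All.lookup x≢ (∈-lookup j))
  lookup-injective {xs = _ ∷ xs} (x≢ ∷ u) {suc i} {zero}  eq =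
    contradiction (sym eq) (All.lookup x≢ (∈-lookup i))
  lookup-injective {xs = _ ∷ xs} (x≢ ∷ u) {suc i} {suc j} eq =
    cong suc (lookup-injective u eq)

-- Stars, face boundaries and walks as chains modulo 2.

module EmbeddingHomology {g : ℕ} (G : CellularEmbedding g) where
  open CellularEmbedding G
  open BinaryLinearAlgebra
  open ≡ using (refl; sym; trans; cong; cong₂; subst)
  open ≡.≡-Reasoning
  open import Algebra.Properties.Semiring.Sum
    (CommutativeRing.semiring Bool.xor-∧-commutativeRing)

  rev-involutive : ∀ x → rev (rev x) ≡ x
  rev-involutive (e , b) = cong (e ,_) (Bool.not-involutive b)

  prev : Dart → Dart
  prev = rev ∘ Inverse.from rotation

  next-prev : ∀ x → next (prev x) ≡ x
  next-prev x = trans (cong (Inverse.to rotation) (rev-involutive _))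
                      (Inverse.strictlyInverseˡ rotation x)

  prev-next : ∀ x → prev (next x) ≡ x
  prev-next x = trans (cong rev (Inverse.strictlyInverseʳ rotation (rev x)))
                      (rev-involutive x)

  next-rev : ∀ x → next (rev x) ≡ Inverse.to rotation x
  next-rev x = cong (Inverse.to rotation) (rev-involutive x)

  tail-next : ∀ x → tail (next x) ≡ head x
  tail-next x = sym (Equivalence.from (tail-orbits (rev x) (next x)) (1 , refl))

  face-next : ∀ x → face (next x) ≡ face x
  face-next x = sym (Equivalence.from (face-orbits x (next x)) (1 , refl))

  star : Vertex → Dart → Bool
  star v x = does (tail x Fin.≟ v) xor does (head x Fin.≟ v)

  star-rev : ∀ v x → star v (rev x) ≡ star v x
  star-rev v x = trans
    (cong (λ y → does (head x Fin.≟ v) xor does (tail y Fin.≟ v)) (rev-involutive x))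
    (Bool.xor-comm (does (head x Fin.≟ v)) _)

  -- A family of multiplicities of darts is turned into a chain of edges by
  -- identifying each dart with its reversal.
  chain : (Dart → Bool) → Fin #E → Bool
  chain m j = m (j , true) xor m (j , false)

  abstract
    ∑ᴰ : (Dart → Bool) → Bool
    ∑ᴰ h = ∑[ j < #E ] (h (j , true) xor h (j , false))

    ∑ᴰ-cong : ∀ {h h′} → (∀ x → h x ≡ h′ x) → ∑ᴰ h ≡ ∑ᴰ h′
    ∑ᴰ-cong eq = sum-cong-≗ {#E} λ j → cong₂ _xor_ (eq (j , true)) (eq (j , false))

    ∑ᴰ-false : ∑ᴰ (λ _ → false) ≡ false
    ∑ᴰ-false = sum-replicate-zero #E

    ∑ᴰ-xor : ∀ h h′ → ∑ᴰ (λ x → h x xor h′ x) ≡ ∑ᴰ h xor ∑ᴰ h′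
    ∑ᴰ-xor h h′ = trans
      (sum-cong-≗ {#E} λ j → xor-interchange (h (j , true)) (h′ (j , true)) (h (j , false)) (h′ (j , false)))
      (∑-distrib-+ {#E} (λ j → h (j , true) xor h (j , false)) (λ j → h′ (j , true) xor h′ (j , false)))

    ∑ᴰ-∑ : ∀ {n} (h : Fin n → Dart → Bool) →
           ∑ᴰ (λ x → ∑[ i < n ] h i x) ≡ ∑[ i < n ] ∑ᴰ (h i)
    ∑ᴰ-∑ {zero}  h = ∑ᴰ-false
    ∑ᴰ-∑ {suc n} h = trans (∑ᴰ-xor (h zero) (λ x → ∑[ i < n ] h (suc i) x))
                           (cong (∑ᴰ (h zero) xor_) (∑ᴰ-∑ (h ∘ suc)))

    ∑ᴰ-comm : ∀ (h : Dart → Dart → Bool) →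
              ∑ᴰ (λ x → ∑ᴰ (λ y → h x y)) ≡ ∑ᴰ (λ y → ∑ᴰ (λ x → h x y))
    ∑ᴰ-comm h = trans
      (∑ᴰ-∑ {#E} (λ j x → h x (j , true) xor h x (j , false)))
      (sum-cong-≗ {#E} λ j → ∑ᴰ-xor (λ x → h x (j , true)) (λ x → h x (j , false)))

    ∑ᴰ-δ : ∀ (h : Dart → Bool) a → ∑ᴰ (λ x → h x ∧ does (a ≟ x)) ≡ h a
    ∑ᴰ-δ h (a , b) = trans (sum-cong-≗ {#E} (single b)) (sum-δ (λ j → h (j , b)) a)
      where
      diagonal : ∀ b j → does ((a , b) ≟ (j , b)) ≡ does (a Fin.≟ j)
      diagonal b j = does-⇔ (mk⇔ (cong proj₁) (cong (_, b))) ((a , b) ≟ (j , b)) (a Fin.≟ j)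

      off : ∀ b b′ j → b ≢ b′ → h (j , b′) ∧ does ((a , b) ≟ (j , b′)) ≡ false
      off b b′ j b≢b′ = trans
        (cong (h (j , b′) ∧_) (dec-false ((a , b) ≟ (j , b′)) (b≢b′ ∘ cong proj₂)))
        (Bool.∧-zeroʳ _)

      single : ∀ b j → h (j , true) ∧ does ((a , b) ≟ (j , true)) xor
                       h (j , false) ∧ does ((a , b) ≟ (j , false)) ≡
                       h (j , b) ∧ does (a Fin.≟ j)
      single true  j = trans (cong ((h (j , true) ∧ does ((a , true) ≟ (j , true))) xor_) (off true false j λ ()))
        (trans (Bool.xor-identityʳ _) (cong (h (j , true) ∧_) (diagonal true j)))
      single false j = trans (cong (_xor (h (j , false) ∧ does ((a , false) ≟ (j , false)))) (off false true j λ ()))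
        (cong (h (j , false) ∧_) (diagonal false j))

    -- A star takes the same value on both darts of an edge, so pairing it with a chain of edges
    -- amounts to pairing it with the multiplicities of the darts.
    star-chain : ∀ v m → ∑[ j < #E ] (star v (j , true) ∧ chain m j) ≡
                         ∑ᴰ (λ x → star v x ∧ m x)
    star-chain v m = sum-cong-≗ {#E} λ j → trans
      (Bool.∧-distribˡ-xor (star v (j , true)) (m (j , true)) (m (j , false)))
      (cong (λ s → star v (j , true) ∧ m (j , true) xor s ∧ m (j , false))
        (sym (star-rev v (j , true))))

  -- Reindexing along the permutation `next`: the value at `next x` is written as a sum against a
  -- delta function, the two sums are exchanged, and the delta is read through `prev`.
  ∑ᴰ-next : ∀ h → ∑ᴰ (h ∘ next) ≡ ∑ᴰ h
  ∑ᴰ-next h = begin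
    ∑ᴰ (λ x → h (next x))
      ≡⟨ ∑ᴰ-cong (λ x → sym (∑ᴰ-δ h (next x))) ⟩
    ∑ᴰ (λ x → ∑ᴰ (λ y → h y ∧ does (next x ≟ y)))
      ≡⟨ ∑ᴰ-comm (λ x y → h y ∧ does (next x ≟ y)) ⟩
    ∑ᴰ (λ y → ∑ᴰ (λ x → h y ∧ does (next x ≟ y)))
      ≡⟨ ∑ᴰ-cong (λ y → trans
           (∑ᴰ-cong λ x → cong (h y ∧_) (does-⇔ (transpose x y) (next x ≟ y) (prev y ≟ x)))
           (∑ᴰ-δ (λ _ → h y) (prev y))) ⟩
    ∑ᴰ h ∎
    where
    transpose : ∀ x y → next x ≡ y ⇔ prev y ≡ x
    transpose x y = mk⇔ (λ eq → trans (cong prev (sym eq)) (prev-next x))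
                        (λ eq → trans (cong next (sym eq)) (next-prev y))

  inFace : Face → Dart → Bool
  inFace f x = does (face x Fin.≟ f)

  -- The head of a dart is the tail of its successor on the same face, so the head terms are the
  -- tail terms reindexed by `next`, and the two cancel.
  star-face : ∀ v f → ∑ᴰ (λ x → star v x ∧ inFace f x) ≡ false
  star-face v f = begin
    ∑ᴰ (λ x → star v x ∧ inFace f x)
      ≡⟨ ∑ᴰ-cong (λ x → Bool.∧-distribʳ-xor (inFace f x) (does (tail x Fin.≟ v)) (does (head x Fin.≟ v))) ⟩
    ∑ᴰ (λ x → t x xor does (head x Fin.≟ v) ∧ inFace f x)
      ≡⟨ ∑ᴰ-xor t _ ⟩
    ∑ᴰ t xor ∑ᴰ (λ x → does (head x Fin.≟ v) ∧ inFace f x)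
      ≡⟨ cong (∑ᴰ t xor_) (∑ᴰ-cong λ x → cong₂ (λ u f′ → does (u Fin.≟ v) ∧ does (f′ Fin.≟ f))
           (sym (tail-next x)) (sym (face-next x))) ⟩
    ∑ᴰ t xor ∑ᴰ (t ∘ next)
      ≡⟨ ≡⇒xor-false (sym (∑ᴰ-next t)) ⟩
    false ∎
    where
    t : Dart → Bool
    t x = does (tail x Fin.≟ v) ∧ inFace f x

  count : List Dart → Dart → Bool
  count xs x = foldr (λ y b → does (y ≟ x) xor b) false xs

  count-++ : ∀ xs ys x → count (xs ++ ys) x ≡ count xs x xor count ys x
  count-++ []       ys x = refl
  count-++ (y ∷ xs) ys x = trans
    (cong (does (y ≟ x) xor_) (count-++ xs ys x))
    (sym (Bool.xor-assoc (does (y ≟ x)) _ _))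

  count-absent : ∀ {xs x} → All (_≢ x) xs → count xs x ≡ false
  count-absent []       = refl
  count-absent {y ∷ _} {x} (y≢x ∷ rest) = cong₂ _xor_ (dec-false (y ≟ x) y≢x) (count-absent rest)

  -- The boundary of a walk telescopes to its two ends. Closed walks are therefore orthogonal to all
  -- stars.
  star-walk : ∀ v {u xs u′} → IsWalk u xs u′ →
              ∑ᴰ (λ x → star v x ∧ count xs x) ≡
              does (u Fin.≟ v) xor does (u′ Fin.≟ v)
  star-walk v {u} {[]} refl = trans
    (trans (∑ᴰ-cong λ x → Bool.∧-zeroʳ (star v x)) ∑ᴰ-false)
    (sym (Bool.xor-same (does (u Fin.≟ v))))
  star-walk v {u} {y ∷ xs} {u′} (refl , walk) = begin
    ∑ᴰ (λ x → star v x ∧ (does (y ≟ x) xor count xs x))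
      ≡⟨ ∑ᴰ-cong (λ x → Bool.∧-distribˡ-xor (star v x) (does (y ≟ x)) (count xs x)) ⟩
    ∑ᴰ (λ x → star v x ∧ does (y ≟ x) xor star v x ∧ count xs x)
      ≡⟨ ∑ᴰ-xor (λ x → star v x ∧ does (y ≟ x)) _ ⟩
    ∑ᴰ (λ x → star v x ∧ does (y ≟ x)) xor ∑ᴰ (λ x → star v x ∧ count xs x)
      ≡⟨ cong₂ _xor_ (∑ᴰ-δ (star v) y) (star-walk v walk) ⟩
    (t xor h) xor (h xor does (u′ Fin.≟ v))
      ≡⟨ Bool.xor-assoc t h _ ⟩
    t xor (h xor (h xor does (u′ Fin.≟ v)))
      ≡⟨ cong (t xor_) (Bool.xor-assoc h h _) ⟨
    t xor ((h xor h) xor does (u′ Fin.≟ v))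
      ≡⟨ cong (λ b → t xor (b xor does (u′ Fin.≟ v))) (Bool.xor-same h) ⟩
    t xor does (u′ Fin.≟ v) ∎
    where
    t = does (tail y Fin.≟ v)
    h = does (head y Fin.≟ v)

  orbit : Dart → ℕ → List Dart
  orbit x zero    = []
  orbit x (suc k) = x ∷ orbit (next x) k

  orbit-walk : ∀ x k → IsWalk (tail x) (orbit x k) (tail (iterate next x k))
  orbit-walk x zero    = refl
  orbit-walk x (suc k) =
    refl , subst (λ u → IsWalk u (orbit (next x) k) (tail (iterate next (next x) k)))
                 (tail-next x) (orbit-walk (next x) k)

  -- This holds even if the orbit returns to x, since multiplicities are taken
  -- modulo 2.
  count-orbit-next : ∀ x k y →
    count (orbit x k) (next y) xor count (orbit x k) y ≡
    does (x ≟ next y) xor does (iterate next x k ≟ next y)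
  count-orbit-next x zero    y = sym (Bool.xor-same (does (x ≟ next y)))
  count-orbit-next x (suc k) y = begin
    (a xor count xs (next y)) xor (does (x ≟ y) xor count xs y)
      ≡⟨ xor-interchange a (count xs (next y)) (does (x ≟ y)) (count xs y) ⟩
    (a xor does (x ≟ y)) xor (count xs (next y) xor count xs y)
      ≡⟨ cong₂ _xor_ (cong (a xor_) (does-⇔ next-injective (x ≟ y) (next x ≟ next y)))
                     (count-orbit-next (next x) k y) ⟩
    (a xor b) xor (b xor c)
      ≡⟨ Bool.xor-assoc a b (b xor c) ⟩
    a xor (b xor (b xor c))
      ≡⟨ cong (a xor_) (Bool.xor-assoc b b c) ⟨
    a xor ((b xor b) xor c)
      ≡⟨ cong (λ d → a xor (d xor c)) (Bool.xor-same b) ⟩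
    a xor c ∎
    where
    xs = orbit (next x) k
    a = does (x ≟ next y)
    b = does (next x ≟ next y)
    c = does (iterate next (next x) k ≟ next y)

    next-injective : x ≡ y ⇔ next x ≡ next y
    next-injective = mk⇔ (cong next) λ eq →
      trans (sym (prev-next x)) (trans (cong prev eq) (prev-next y))

  walk-++ : ∀ {u xs v ys z} → IsWalk u xs v → IsWalk v ys z → IsWalk u (xs ++ ys) z
  walk-++ {xs = []}    refl       q = q
  walk-++ {xs = _ ∷ _} (refl , p) q = refl , walk-++ p q

  walk-invariant : ∀ {a} {A : Set a} (c : Vertex → A) →
                   (∀ x → c (tail x) ≡ c (head x)) →
                   ∀ {u xs v} → IsWalk u xs v → c u ≡ c v
  walk-invariant c eq {xs = []}     refl       = refl
  walk-invariant c eq {xs = x ∷ xs} (refl , p) = trans (eq x) (walk-invariant c eq p)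

  rotation-invariant : ∀ (Y : Dart → Bool) {v} →
    (∀ x → tail x ≡ v → Y (Inverse.to rotation x) ≡ Y x) →
    ∀ {x x′} → tail x ≡ v → tail x′ ≡ v → Y x ≡ Y x′
  rotation-invariant Y {v} eq {x} {x′} p p′ =
    let k , q = Equivalence.to (tail-orbits x x′) (trans p (sym p′))
    in trans (iterated k x p) (cong Y q)
    where
    iterated : ∀ k x → tail x ≡ v → Y x ≡ Y (iterate (Inverse.to rotation) x k)
    iterated zero    x p = refl
    iterated (suc k) x p = trans (sym (eq x p))
      (iterated k _ (trans (sym (Equivalence.from (tail-orbits x _) (1 , refl))) p))

  -- This is connectedness of the dual graph. Rotation is `next` after `rev`, so turning around a
  -- vertex only crosses edges and follows faces; walks of `G` then carry the value from vertex to
  -- vertex.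
  face-invariant : ∀ (y : Face → Bool) → (∀ x → y (face x) ≡ y (face (rev x))) →
                   ∀ f f′ → y f ≡ y f′
  face-invariant y eq f f′ =
    let x , p = face-surjective f
        x′ , p′ = face-surjective f′
        xs , walk = connected (tail x) (tail x′)
    in trans (cong y (sym p)) (trans (along walk refl refl) (cong y p′))
    where
    around : ∀ {v x x′} → tail x ≡ v → tail x′ ≡ v → y (face x) ≡ y (face x′)
    around = rotation-invariant (y ∘ face) λ x _ → begin
      y (face (Inverse.to rotation x)) ≡⟨ cong (y ∘ face) (next-rev x) ⟨
      y (face (next (rev x)))          ≡⟨ cong y (face-next (rev x)) ⟩
      y (face (rev x))                 ≡⟨ eq x ⟨
      y (face x)                       ∎

    along : ∀ {u xs v} → IsWalk u xs v → ∀ {x x′} → tail x ≡ u → tail x′ ≡ v →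
            y (face x) ≡ y (face x′)
    along {xs = []}     refl       p p′ = around p p′
    along {xs = z ∷ xs} (refl , q) p p′ =
      trans (around p refl) (trans (eq z) (along q refl p′))

-- At most 2g crossings of a face besides a base crossing.

module FaceCrossings {g : ℕ} (G : CellularEmbedding g) where
  open CellularEmbedding G
  open EmbeddingHomology G
  open BinaryLinearAlgebra
  open ≡ using (refl; sym; trans; cong; cong₂; subst; subst₂)
  open ≡.≡-Reasoning
  open import Algebra.Properties.Semiring.Sum
    (CommutativeRing.semiring Bool.xor-∧-commutativeRing)

  Adjacent : (Vertex → Bool) → Bool → Vertex → Vertex → Set
  Adjacent colour b u v =
    ∃ λ x → (tail x ≡ u × head x ≡ v) × colour u ≡ b × colour v ≡ b

  Connected : (Vertex → Bool) → Bool → Vertex → Vertex → Set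
  Connected colour b = Star (Adjacent colour b)

  connected-walk : ∀ {colour b u v} → Connected colour b u v →
    ∃ λ xs → IsWalk u xs v × All (λ x → colour (tail x) ≡ b × colour (head x) ≡ b) xs
  connected-walk ε = [] , refl , []
  connected-walk ((x , (refl , refl) , p , q) ◅ path) =
    let xs , walk , mono = connected-walk path
    in x ∷ xs , (refl , walk) , (p , q) ∷ mono

  -- The crossing `x₀` is kept apart because it is the common base point of the loops: only the
  -- remaining `xs` contribute a cycle each. Both colours need to be connected merely between the
  -- ends of the crossings.
  record Crossings (f : Face) (colour : Vertex → Bool) (x₀ : Dart) (xs : List Dart) : Set where
    field
      unique     : Unique (x₀ ∷ xs)
      onFace     : ∀ {x} → x ∈ x₀ ∷ xs → face x ≡ f
      tail-false : ∀ {x} → x ∈ x₀ ∷ xs → colour (tail x) ≡ false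
      head-true  : ∀ {x} → x ∈ x₀ ∷ xs → colour (head x) ≡ true
      tails      : ∀ {x} → x ∈ x₀ ∷ xs → Connected colour false (tail x) (tail x₀)
      heads      : ∀ {x} → x ∈ x₀ ∷ xs → Connected colour true (head x) (head x₀)

  module _ {f colour x₀ xs} (crossings : Crossings f colour x₀ xs) where
    open Crossings crossings

    x₀∈ : x₀ ∈ x₀ ∷ xs
    x₀∈ = here refl

    dart : Fin (length xs) → Dart
    dart = lookup xs

    dart∈ : ∀ i → dart i ∈ x₀ ∷ xs
    dart∈ i = there (∈-lookup i)

    steps : ∀ {x} → face x ≡ f → ∃ λ k → iterate next x₀ k ≡ x
    steps p = Equivalence.to (face-orbits x₀ _) (trans (onFace x₀∈) (sym p))

    stepsTo : ∀ i → ∃ λ k → iterate next x₀ k ≡ dart i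
    stepsTo i = steps (onFace (dart∈ i))

    return : ∀ i → ∃ λ ys → IsWalk (tail (dart i)) ys (tail x₀) ×
                            All (λ x → colour (tail x) ≡ false × colour (head x) ≡ false) ys
    return i = connected-walk (tails (dart∈ i))

    arc back : Fin (length xs) → List Dart
    arc i  = orbit x₀ (proj₁ (stepsTo i))
    back i = proj₁ (return i)

    loop : ∀ i → IsWalk (tail x₀) (arc i ++ back i) (tail x₀)
    loop i = walk-++
      (subst (λ x → IsWalk (tail x₀) (arc i) (tail x)) (proj₂ (stepsTo i))
             (orbit-walk x₀ (proj₁ (stepsTo i))))
      (proj₁ (proj₂ (return i)))

    -- The first two coordinates normalise the vertex x₀ starts at and the
    -- face f, making the stars and the face boundaries independent.
    stars : Fin #V → Fin (2 ℕ.+ #E) → Bool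
    stars v zero          = does (tail x₀ Fin.≟ v)
    stars v (suc zero)    = false
    stars v (suc (suc j)) = star v (j , true)

    multiplicity : Fin #F ⊎ Fin (length xs) → Dart → Bool
    multiplicity (inj₁ f′) = inFace f′
    multiplicity (inj₂ i)  = count (arc i ++ back i)

    cycle : Fin #F ⊎ Fin (length xs) → Fin (2 ℕ.+ #E) → Bool
    cycle _         zero          = false
    cycle s         (suc (suc j)) = chain (multiplicity s) j
    cycle (inj₁ f′) (suc zero)    = does (f Fin.≟ f′)
    cycle (inj₂ _)  (suc zero)    = false

    cycles : Fin (#F ℕ.+ length xs) → Fin (2 ℕ.+ #E) → Bool
    cycles = cycle ∘ splitAt #F

    star-multiplicity : ∀ v s → ∑ᴰ (λ x → star v x ∧ multiplicity s x) ≡ false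
    star-multiplicity v (inj₁ f′) = star-face v f′
    star-multiplicity v (inj₂ i)  = trans (star-walk v (loop i)) (Bool.xor-same (does (tail x₀ Fin.≟ v)))

    orthogonal : ∀ v i → Orthogonal (stars v) (cycles i)
    orthogonal v i = cong₂ _xor_ (Bool.∧-zeroʳ (does (tail x₀ Fin.≟ v)))
      (trans (star-chain v (multiplicity (splitAt #F i))) (star-multiplicity v (splitAt #F i)))

    -- The edge coordinates make the coefficients agree across every edge, hence everywhere by
    -- connectedness; the extra coordinate makes the one at `tail x₀` vanish.
    stars-independent : Independent stars
    stars-independent c vanishes v = trans (sym (walk-invariant c across (proj₂ (connected (tail x₀) v)))) root
      where
      root : c (tail x₀) ≡ false
      root = trans (sym (sum-δ c (tail x₀))) (vanishes zero)

      edge : ∀ j → c (tail (j , true)) ≡ c (head (j , true))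
      edge j = xor-false⇒≡ (begin
        c (tail (j , true)) xor c (head (j , true))
          ≡⟨ cong₂ _xor_ (sum-δ c (tail (j , true))) (sum-δ c (head (j , true))) ⟨
        ∑[ v < #V ] (c v ∧ does (tail (j , true) Fin.≟ v)) xor
        ∑[ v < #V ] (c v ∧ does (head (j , true) Fin.≟ v))
          ≡⟨ sum-∧-xor {#V} c (λ v → does (tail (j , true) Fin.≟ v)) (λ v → does (head (j , true) Fin.≟ v)) ⟨
        ∑[ v < #V ] (c v ∧ star v (j , true))
          ≡⟨ vanishes (suc (suc j)) ⟩
        false ∎)

      across : ∀ x → c (tail x) ≡ c (head x)
      across (j , true)  = edge j
      across (j , false) = sym (edge j)

    -- Here `y` and `d` are the coefficients of the face boundaries and of the loops in a vanishing
    -- combination. Over F₂ the combination vanishes on an edge exactly if its two darts have equal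
    -- total multiplicities, which is `balanced`.
    module Independence
      (y : Fin #F → Bool) (d : Fin (length xs) → Bool)
      (normalised : y f ≡ false)
      (balanced : ∀ x →
        y (face x) xor ∑[ i < length xs ] (d i ∧ count (arc i ++ back i) x) ≡
        y (face (rev x)) xor ∑[ i < length xs ] (d i ∧ count (arc i ++ back i) (rev x)))
      where

      -- The total multiplicity of a dart with the return paths `back` left out. At darts touching
      -- the colour `true` nothing is lost by this, and along a face `S` changes in a controlled
      -- way.
      S Y : Dart → Bool
      S x = ∑[ i < length xs ] (d i ∧ count (arc i) x)
      Y x = y (face x) xor S x

      back-absent : ∀ x → colour (tail x) ≡ true ⊎ colour (head x) ≡ true →
                    ∀ i → count (back i) x ≡ false
      back-absent x touches i = count-absent (All.map apart (proj₂ (proj₂ (return i))))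
        where
        clash : ∀ {a} → a ≡ true → a ≡ false → ∀ {b} {B : Set b} → B
        clash refl ()

        apart : ∀ {z} → colour (tail z) ≡ false × colour (head z) ≡ false → z ≢ x
        apart (p , q) refl = [ (λ t → clash t p) , (λ h → clash h q) ]′ touches

      S-touching : ∀ x → colour (tail x) ≡ true ⊎ colour (head x) ≡ true →
                   ∑[ i < length xs ] (d i ∧ count (arc i ++ back i) x) ≡ S x
      S-touching x touches = sum-cong-≗ {length xs} λ i → cong (d i ∧_)
        (trans (count-++ (arc i) (back i) x)
          (trans (cong (count (arc i) x xor_) (back-absent x touches i)) (Bool.xor-identityʳ _)))

      Y-rev : ∀ x → colour (tail x) ≡ true → Y x ≡ Y (rev x)
      Y-rev x p = begin
        Y x ≡⟨ cong (y (face x) xor_) (S-touching x (inj₁ p)) ⟨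
        _   ≡⟨ balanced x ⟩
        _   ≡⟨ cong (y (face (rev x)) xor_) (S-touching (rev x)
                 (inj₂ (trans (cong (colour ∘ tail) (rev-involutive x)) p))) ⟩
        Y (rev x) ∎

      S-next : ∀ x → S (next x) xor S x ≡
               ∑[ i < length xs ] (d i ∧ (does (x₀ ≟ next x) xor does (dart i ≟ next x)))
      S-next x = trans
        (sym (sum-∧-xor {length xs} d (λ i → count (arc i) (next x)) (λ i → count (arc i) x)))
        (sum-cong-≗ {length xs} λ i → cong (d i ∧_) (trans
          (count-orbit-next x₀ (proj₁ (stepsTo i)) x)
          (cong (λ z → does (x₀ ≟ next x) xor does (z ≟ next x)) (proj₂ (stepsTo i)))))

      -- An arc starts at `x₀` and stops just before its own crossing, so its multiplicity can
      -- change along the face only on reaching one of these darts.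
      S-next-∉ : ∀ x → next x ∉ x₀ ∷ xs → S (next x) ≡ S x
      S-next-∉ x ∉xs = xor-false⇒≡ (trans (S-next x) (sum-false {length xs} _ λ i → trans
        (cong (d i ∧_) (cong₂ _xor_
          (dec-false (x₀ ≟ next x) λ eq → ∉xs (subst (_∈ x₀ ∷ xs) eq x₀∈))
          (dec-false (dart i ≟ next x) λ eq → ∉xs (subst (_∈ x₀ ∷ xs) eq (dart∈ i)))))
        (Bool.∧-zeroʳ (d i))))

      next-∉ : ∀ x → colour (head x) ≡ true → next x ∉ x₀ ∷ xs
      next-∉ x p ∈xs = case trans (sym p) (trans (cong colour (sym (tail-next x))) (tail-false ∈xs)) of λ ()

      Y-next : ∀ x → colour (head x) ≡ true → Y (next x) ≡ Y x
      Y-next x p = cong₂ _xor_ (cong y (face-next x)) (S-next-∉ x (next-∉ x p))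

      -- Rotation at `v` is `rev` followed by `next`. Both preserve `Y` there: no return path uses
      -- the edge, and no crossing starts at a vertex of colour `true`.
      Y-around : ∀ {v} → colour v ≡ true → ∀ {x x′} → tail x ≡ v → tail x′ ≡ v → Y x ≡ Y x′
      Y-around p = rotation-invariant Y λ { x refl → begin
        Y (Inverse.to rotation x) ≡⟨ cong Y (next-rev x) ⟨
        Y (next (rev x))          ≡⟨ Y-next (rev x) (trans (cong (colour ∘ tail) (rev-involutive x)) p) ⟩
        Y (rev x)                 ≡⟨ Y-rev x p ⟨
        Y x                       ∎ }

      Y-connected : ∀ {u v} → Connected colour true u v → colour v ≡ true →
                    ∀ {x x′} → tail x ≡ u → tail x′ ≡ v → Y x ≡ Y x′
      Y-connected ε r p p′ = Y-around r p p′
      Y-connected ((z , (refl , refl) , a , _) ◅ path) r p p′ =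
        trans (Y-around a p refl) (trans (Y-rev z a) (Y-connected path r refl p′))

      -- From a crossing, `Y` is carried to its head, through the connected colour `true` to the
      -- head of `x₀`, and back to `x₀`. On `f` the face coefficient vanishes, so `Y` is `S` at both
      -- ends.
      S-crossing : ∀ {x} → x ∈ x₀ ∷ xs → S x ≡ S x₀
      S-crossing {x} x∈ = begin
        S x                ≡⟨ Y-face x x∈ ⟨
        Y x                ≡⟨ Y-next x (head-true x∈) ⟨
        Y (next x)         ≡⟨ Y-connected (heads x∈) (head-true x₀∈) (tail-next x) (tail-next x₀) ⟩
        Y (next x₀)        ≡⟨ Y-next x₀ (head-true x₀∈) ⟩
        Y x₀               ≡⟨ Y-face x₀ x₀∈ ⟩
        S x₀               ∎
        where
        Y-face : ∀ x → x ∈ x₀ ∷ xs → Y x ≡ S x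
        Y-face x x∈ = cong (_xor S x) (trans (cong y (onFace x∈)) normalised)

      -- Along the face, `S` could change only on entering a crossing, and there its value is
      -- already fixed by `S-crossing`.
      S-face : ∀ {x} → face x ≡ f → S x ≡ S x₀
      S-face p = let k , eq = steps p in trans (cong S (sym eq)) (iterated k x₀ refl)
        where
        step : ∀ x → S x ≡ S x₀ → S (next x) ≡ S x₀
        step x eq with any? (next x ≟_) (x₀ ∷ xs)
        ... | yes ∈xs = S-crossing ∈xs
        ... | no  ∉xs = trans (S-next-∉ x ∉xs) eq

        iterated : ∀ k x → S x ≡ S x₀ → S (iterate next x k) ≡ S x₀
        iterated zero    x eq = eq
        iterated (suc k) x eq = iterated k (next x) (step x eq)

      -- Between the predecessor of `dart i` and `dart i` the sum `S` jumps by exactly `d i`, since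
      -- the crossings are distinct from each other and from `x₀`. But `S` is constant on the face.
      d-false : ∀ i → d i ≡ false
      d-false i = begin
        d i
          ≡⟨ sum-δ d i ⟨
        ∑[ j < length xs ] (d j ∧ does (i Fin.≟ j))
          ≡⟨ sum-cong-≗ {length xs} (λ j → cong (d j ∧_) (trans
               (does-⇔ (mk⇔ (λ eq → cong dart (sym eq)) (λ eq → sym (lookup-injective unique-xs eq)))
                       (i Fin.≟ j) (dart j ≟ dart i))
               (cong (_xor does (dart j ≟ dart i)) (sym (dec-false (x₀ ≟ dart i) x₀≢))))) ⟩
        ∑[ j < length xs ] (d j ∧ (does (x₀ ≟ dart i) xor does (dart j ≟ dart i)))
          ≡⟨ cong (λ z → ∑[ j < length xs ] (d j ∧ (does (x₀ ≟ z) xor does (dart j ≟ z)))) (next-prev (dart i)) ⟨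
        ∑[ j < length xs ] (d j ∧ (does (x₀ ≟ next x) xor does (dart j ≟ next x)))
          ≡⟨ S-next x ⟨
        S (next x) xor S x
          ≡⟨ ≡⇒xor-false (trans (S-face (trans (cong face (next-prev (dart i))) (onFace (dart∈ i))))
               (sym (S-face {x} (trans (sym (face-next x)) (trans (cong face (next-prev (dart i))) (onFace (dart∈ i))))))) ⟩
        false ∎
        where
        x = prev (dart i)

        unique-xs : Unique xs
        unique-xs with _ ∷ u ← unique = u

        x₀≢ : x₀ ≢ dart i
        x₀≢ with x₀≢xs ∷ _ ← unique = All.lookup x₀≢xs (∈-lookup i)

      -- With the loops gone, `balanced` equates the coefficients of the two faces along every edge,
      -- and one of the coefficients is normalised to vanish.
      y-false : ∀ f′ → y f′ ≡ false
      y-false f′ = trans (face-invariant y balanced′ f′ f) normalised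
        where
        none : ∀ x → ∑[ i < length xs ] (d i ∧ count (arc i ++ back i) x) ≡ false
        none x = sum-false {length xs} _ λ i → cong (_∧ count (arc i ++ back i) x) (d-false i)

        drop : ∀ x → y (face x) ≡ y (face x) xor ∑[ i < length xs ] (d i ∧ count (arc i ++ back i) x)
        drop x = sym (trans (cong (y (face x) xor_) (none x)) (Bool.xor-identityʳ _))

        balanced′ : ∀ x → y (face x) ≡ y (face (rev x))
        balanced′ x = trans (drop x) (trans (balanced x) (sym (drop (rev x))))

    cycles-independent : Independent cycles
    cycles-independent c vanishes i = trans (cong c (sym (Fin.join-splitAt #F (length xs) i)))
                                            (c′-false (splitAt #F i))
      where
      c′ : Fin #F ⊎ Fin (length xs) → Bool
      c′ = c ∘ join #F (length xs)

      y = c′ ∘ inj₁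
      d = c′ ∘ inj₂

      total : (Fin #F ⊎ Fin (length xs) → Bool) → Bool
      total h = ∑[ f′ < #F ] (y f′ ∧ h (inj₁ f′)) xor ∑[ i < length xs ] (d i ∧ h (inj₂ i))

      split : ∀ k → total (λ s → cycle s k) ≡ false
      split k = begin
        total (λ s → cycle s k)
          ≡⟨ sum-⊎ #F (λ s → c′ s ∧ cycle s k) ⟨
        ∑[ i < #F ℕ.+ length xs ] (c′ (splitAt #F i) ∧ cycles i k)
          ≡⟨ sum-cong-≗ {#F ℕ.+ length xs} (λ i → cong (λ j → c j ∧ cycles i k) (Fin.join-splitAt #F (length xs) i)) ⟩
        ∑[ i < #F ℕ.+ length xs ] (c i ∧ cycles i k)
          ≡⟨ vanishes k ⟩
        false ∎

      normalised : y f ≡ false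
      normalised = begin
        y f           ≡⟨ sum-δ y f ⟨
        ∑[ f′ < #F ] (y f′ ∧ does (f Fin.≟ f′)) ≡⟨ Bool.xor-identityʳ _ ⟨
        _             ≡⟨ cong (∑[ f′ < #F ] (y f′ ∧ does (f Fin.≟ f′)) xor_) (sum-false {length xs} _ λ i → Bool.∧-zeroʳ (d i)) ⟨
        total (λ s → cycle s (suc zero)) ≡⟨ split (suc zero) ⟩
        false         ∎

      M : Dart → Bool
      M x = total (λ s → multiplicity s x)

      edge : ∀ j → M (j , true) ≡ M (j , false)
      edge j = xor-false⇒≡ (begin
        M (j , true) xor M (j , false)
          ≡⟨ xor-interchange (∑[ f′ < #F ] (y f′ ∧ inFace f′ (j , true))) _ (∑[ f′ < #F ] (y f′ ∧ inFace f′ (j , false))) _ ⟩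
        _ ≡⟨ cong₂ _xor_ (sum-∧-xor {#F} y (λ f′ → inFace f′ (j , true)) (λ f′ → inFace f′ (j , false)))
                         (sum-∧-xor {length xs} d (λ i → multiplicity (inj₂ i) (j , true)) (λ i → multiplicity (inj₂ i) (j , false))) ⟨
        total (λ s → cycle s (suc (suc j)))
          ≡⟨ split (suc (suc j)) ⟩
        false ∎)

      M-face : ∀ x → M x ≡ y (face x) xor ∑[ i < length xs ] (d i ∧ count (arc i ++ back i) x)
      M-face x = cong (_xor ∑[ i < length xs ] (d i ∧ count (arc i ++ back i) x)) (sum-δ y (face x))

      M-rev : ∀ x → M x ≡ M (rev x)
      M-rev (j , true)  = edge j
      M-rev (j , false) = sym (edge j)

      open Independence y d normalised (λ x → trans (sym (M-face x)) (trans (M-rev x) (M-face (rev x))))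

      c′-false : ∀ s → c′ s ≡ false
      c′-false (inj₁ f′) = y-false f′
      c′-false (inj₂ i)  = d-false i

    -- All stars and all faces are counted, at the price of two normalising coordinates. The
    -- resulting V + (F + n) ≤ 2 + E is compared with Euler's formula, whose constant 2 absorbs
    -- them.
    crossings-bound : length xs ℕ.≤ 2 ℕ.* g
    crossings-bound = ℕ.+-cancelˡ-≤ (#V ℕ.+ #F) _ _
      (subst₂ ℕ._≤_ (sym (ℕ.+-assoc #V #F (length xs))) (trans (ℕ.+-comm 2 #E) (sym euler))
        (independent-orthogonal-bound stars cycles
          stars-independent cycles-independent orthogonal))

-- Arithmetic in ordered fields.

module OrderedFieldProperties {c ℓ₁ ℓ₂} (K : OrderedField c ℓ₁ ℓ₂) where
  open OrderedField K
  open IsStrictTotalOrder isStrictTotalOrder public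
    using (compare; isStrictPartialOrder)
    renaming (trans to <-trans; irrefl to <-irrefl; <-respˡ-≈ to <-respˡ; <-respʳ-≈ to <-respʳ)
  private
    module NonStrict = StrictToNonStrict _≈_ _<_

  strictPartialOrder : StrictPartialOrder c ℓ₁ ℓ₂
  strictPartialOrder = record { isStrictPartialOrder = isStrictPartialOrder }

  module ≤-Reasoning = StrictReasoning strictPartialOrder
  open ≤-Reasoning
  open CommutativeSemigroup +-commutativeSemigroup public
    using (interchange; x∙yz≈y∙xz)
  open AbelianGroup +-abelianGroup using (x∙y⁻¹≈ε⇒x≈y)

  <⇒≱ : ∀ {x y} → x < y → ¬ (y ≤ x)
  <⇒≱ x<y (inj₁ y<x) = <-irrefl refl (<-trans x<y y<x)
  <⇒≱ x<y (inj₂ y≈x) = <-irrefl (sym y≈x) x<y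

  ≤-trans : ∀ {x y z} → x ≤ y → y ≤ z → x ≤ z
  ≤-trans = NonStrict.trans isEquivalence
    (IsStrictTotalOrder.<-resp-≈ isStrictTotalOrder) <-trans

  ≤-antisym : ∀ {x y} → x ≤ y → y ≤ x → x ≈ y
  ≤-antisym = NonStrict.antisym isEquivalence <-trans <-irrefl

  +-monoˡ-< : ∀ z {x y} → x < y → x + z < y + z
  +-monoˡ-< z {x} {y} x<y = <-respˡ (+-comm z x) (<-respʳ (+-comm z y) (+-monoʳ-< z x<y))

  +-monoʳ-≤ : ∀ x {y z} → y ≤ z → x + y ≤ x + z
  +-monoʳ-≤ x = Sum.map (+-monoʳ-< x) +-congˡ

  +-monoˡ-≤ : ∀ z {x y} → x ≤ y → x + z ≤ y + z
  +-monoˡ-≤ z = Sum.map (+-monoˡ-< z) +-congʳ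

  +-mono-≤ : ∀ {x y u v} → x ≤ y → u ≤ v → x + u ≤ y + v
  +-mono-≤ {y = y} {u} x≤y u≤v = ≤-trans (+-monoˡ-≤ u x≤y) (+-monoʳ-≤ y u≤v)

  +-cancelˡ-≤ : ∀ x {y z} → x + y ≤ x + z → y ≤ z
  +-cancelˡ-≤ x {y} {z} le with compare y z
  ... | tri< y<z _ _ = inj₁ y<z
  ... | tri≈ _ y≈z _ = inj₂ y≈z
  ... | tri> _ _ z<y = contradiction le (<⇒≱ (+-monoʳ-< x z<y))

  +-cancelʳ-< : ∀ z {x y} → x + z < y + z → x < y
  +-cancelʳ-< z {x} {y} lt with compare x y
  ... | tri< x<y _ _ = x<y
  ... | tri≈ _ x≈y _ = contradiction lt (<-irrefl (+-congʳ x≈y))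
  ... | tri> _ _ y<x = contradiction (inj₁ (+-monoˡ-< z y<x)) (<⇒≱ lt)

  *-monoˡ-< : ∀ {c x y} → 0# < c → x < y → x * c < y * c
  *-monoˡ-< {c} {x} {y} 0<c x<y = begin-strict
    x * c               ≈⟨ +-identityʳ (x * c) ⟨
    x * c + 0#          <⟨ +-monoʳ-< (x * c) (*-pos 0<y-x 0<c) ⟩
    x * c + (y - x) * c ≈⟨ distribʳ c x (y - x) ⟨
    (x + (y - x)) * c   ≈⟨ *-congʳ (x∙yz≈y∙xz x y (- x)) ⟩
    (y + (x - x)) * c   ≈⟨ *-congʳ (+-congˡ (-‿inverseʳ x)) ⟩
    (y + 0#) * c        ≈⟨ *-congʳ (+-identityʳ y) ⟩
    y * c               ∎
    where
    0<y-x : 0# < y - x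
    0<y-x = <-respˡ (-‿inverseʳ x) (+-monoˡ-< (- x) x<y)

  *-monoˡ-≤ : ∀ {c x y} → 0# ≤ c → x ≤ y → x * c ≤ y * c
  *-monoˡ-≤ 0≤c        (inj₂ x≈y) = inj₂ (*-congʳ x≈y)
  *-monoˡ-≤ (inj₁ 0<c) (inj₁ x<y) = inj₁ (*-monoˡ-< 0<c x<y)
  *-monoˡ-≤ {c} {x} {y} (inj₂ 0≈c) (inj₁ _) = inj₂ (trans (vanish x) (sym (vanish y)))
    where
    vanish : ∀ z → z * c ≈ 0#
    vanish z = trans (*-congˡ (sym 0≈c)) (zeroʳ z)

  *-nonNegative : ∀ {x y} → 0# ≤ x → 0# ≤ y → 0# ≤ x * y
  *-nonNegative {x} {y} 0≤x 0≤y = begin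
    0#     ≈⟨ zeroˡ y ⟨
    0# * y ≤⟨ *-monoˡ-≤ 0≤y 0≤x ⟩
    x * y  ∎

  +-nonNegative : ∀ {x y} → 0# ≤ x → 0# ≤ y → 0# ≤ x + y
  +-nonNegative {x} {y} 0≤x 0≤y = begin
    0#      ≈⟨ +-identityʳ 0# ⟨
    0# + 0# ≤⟨ +-mono-≤ 0≤x 0≤y ⟩
    x + y   ∎

  x-y+y+z≈x+z : ∀ x y z → (x - y) + (y + z) ≈ x + z
  x-y+y+z≈x+z x y z = begin-equality
    (x - y) + (y + z)   ≈⟨ +-assoc x (- y) (y + z) ⟩
    x + (- y + (y + z)) ≈⟨ +-congˡ (+-assoc (- y) y z) ⟨
    x + ((- y + y) + z) ≈⟨ +-congˡ (+-congʳ (-‿inverseˡ y)) ⟩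
    x + (0# + z)        ≈⟨ +-congˡ (+-identityˡ z) ⟩
    x + z               ∎

  x-y<u-v⇒x+v<u+y : ∀ {x y u v} → x - y < u - v → x + v < u + y
  x-y<u-v⇒x+v<u+y {x} {y} {u} {v} lt = begin-strict
    x + v             ≈⟨ x-y+y+z≈x+z x y v ⟨
    (x - y) + (y + v) <⟨ +-monoˡ-< (y + v) lt ⟩
    (u - v) + (y + v) ≈⟨ +-congˡ (+-comm y v) ⟩
    (u - v) + (v + y) ≈⟨ x-y+y+z≈x+z u v y ⟩
    u + y             ∎

  x-y≈0⇒x≈y : ∀ {x y} → x - y ≈ 0# → x ≈ y
  x-y≈0⇒x≈y {x} {y} = x∙y⁻¹≈ε⇒x≈y x y

  1-x+x≈1 : ∀ x → (1# - x) + x ≈ 1#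
  1-x+x≈1 x = trans (+-assoc 1# (- x) x) (trans (+-congˡ (-‿inverseˡ x)) (+-identityʳ 1#))

  1-anti-< : ∀ {x y} → x < y → 1# - y < 1# - x
  1-anti-< {x} {y} x<y = +-cancelʳ-< x (begin-strict
    (1# - y) + x <⟨ +-monoʳ-< (1# - y) x<y ⟩
    (1# - y) + y ≈⟨ 1-x+x≈1 y ⟩
    1#           ≈⟨ 1-x+x≈1 x ⟨
    (1# - x) + x ∎)

  1-nonNegative : ∀ {x} → x ≤ 1# → 0# ≤ 1# - x
  1-nonNegative {x} (inj₁ x<1) = inj₁ (<-respˡ (-‿inverseʳ x) (+-monoˡ-< (- x) x<1))
  1-nonNegative {x} (inj₂ x≈1) = inj₂ (sym (trans (+-congʳ (sym x≈1)) (-‿inverseʳ x)))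

  partition : ∀ t w → t * w + (1# - t) * w ≈ w
  partition t w = begin-equality
    t * w + (1# - t) * w ≈⟨ distribʳ w t (1# - t) ⟨
    (t + (1# - t)) * w   ≈⟨ *-congʳ (trans (+-comm t (1# - t)) (1-x+x≈1 t)) ⟩
    1# * w               ≈⟨ *-identityˡ w ⟩
    w                    ∎

  -- Used to compare a slack at two times: `a` and `b` are the path weights that do not depend on
  -- the time, and cancelling them leaves only the halves of the subdivided edge.
  crossed-difference : ∀ {x y x′ y′ a b} →
    (x + a) - (y + b) < (x′ + a) - (y′ + b) → x + y′ < x′ + y
  crossed-difference {x} {y} {x′} {y′} {a} {b} lt = +-cancelʳ-< (a + b) (begin-strict
    (x + y′) + (a + b) ≈⟨ interchange x a y′ b ⟨
    (x + a) + (y′ + b) <⟨ x-y<u-v⇒x+v<u+y lt ⟩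
    (x′ + a) + (y + b) ≈⟨ interchange x′ a y b ⟩
    (x′ + y) + (a + b) ∎)

  1-anti-≤ : ∀ {x y} → x ≤ y → 1# - y ≤ 1# - x
  1-anti-≤ (inj₁ x<y) = inj₁ (1-anti-< x<y)
  1-anti-≤ (inj₂ x≈y) = inj₂ (+-congˡ (-‿cong (sym x≈y)))

  -- As the time grows, the left side of the equation does not increase and the right side does not
  -- decrease, and one of the two is strictly monotone.
  balance-unique-< : ∀ {u v a b s t} → 0# ≤ u → 0# ≤ v → 0# < u ⊎ 0# < v →
    (1# - s) * u + a ≈ s * v + b → (1# - t) * u + a ≈ t * v + b → ¬ (s < t)
  balance-unique-< {u} {v} {a} {b} {s} {t} _ 0≤v (inj₁ 0<u) eq eq′ s<t = <-irrefl eq′ (begin-strict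
    (1# - t) * u + a <⟨ +-monoˡ-< a (*-monoˡ-< 0<u (1-anti-< s<t)) ⟩
    (1# - s) * u + a ≈⟨ eq ⟩
    s * v + b        ≤⟨ +-monoˡ-≤ b (*-monoˡ-≤ 0≤v (inj₁ s<t)) ⟩
    t * v + b        ∎)
  balance-unique-< {u} {v} {a} {b} {s} {t} 0≤u _ (inj₂ 0<v) eq eq′ s<t = <-irrefl eq′ (begin-strict
    (1# - t) * u + a ≤⟨ +-monoˡ-≤ a (*-monoˡ-≤ 0≤u (1-anti-≤ (inj₁ s<t))) ⟩
    (1# - s) * u + a ≈⟨ eq ⟩
    s * v + b        <⟨ +-monoˡ-< b (*-monoˡ-< 0<v s<t) ⟩
    t * v + b        ∎)

  balance-unique : ∀ {u v a b s t} → 0# ≤ u → 0# ≤ v → 0# < u ⊎ 0# < v →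
    (1# - s) * u + a ≈ s * v + b → (1# - t) * u + a ≈ t * v + b → s ≈ t
  balance-unique {s = s} {t} 0≤u 0≤v pos eq eq′ with compare s t
  ... | tri< s<t _ _ = contradiction s<t (balance-unique-< 0≤u 0≤v pos eq eq′)
  ... | tri≈ _ s≈t _ = s≈t
  ... | tri> _ _ t<s = contradiction t<s (balance-unique-< 0≤u 0≤v pos eq′ eq)

-- Tree paths in the subdivided graph and what a pivot means in `G`.

unique-∷ʳ : ∀ {a} {A : Set a} {xs : List A} {x} → Unique xs → x ∉ xs → Unique (xs ∷ʳ x)
unique-∷ʳ u x∉xs = Unique.++⁺ u ([] ∷ []) λ { (x∈xs , here ≡.refl) → x∉xs x∈xs }

module SubdividedEdge {c ℓ₁ ℓ₂} (K : OrderedField c ℓ₁ ℓ₂) {g : ℕ} (G : CellularEmbedding g)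
                      (w : CellularEmbedding.Dart G → OrderedField.Carrier K)
                      (nonNegative : MovingSource.NonNegative K G w)
                      (e : CellularEmbedding.Dart G) where
  open OrderedField K
  open OrderedFieldProperties K
  open CellularEmbedding G
  open MovingSource K G w
  open Weighted K w
  open EmbeddingHomology G using (rev-involutive)

  Walkᴿ : SubVertex → List SubDart → SubVertex → Set
  Walkᴿ = Sub.IsWalk e

  weightᴿ : Carrier → List SubDart → Carrier
  weightᴿ t = At.weight e t

  OnEdge : Dart → Set
  OnEdge x = x ≡ e ⊎ x ≡ rev e

  onEdge? : ∀ x → Dec (OnEdge x)
  onEdge? x = (x ≟ e) ⊎-dec (x ≟ rev e)

  rev≢ : rev e ≢ e
  rev≢ eq = Bool.not-¬ ≡.refl (≡.sym (≡.cong proj₂ eq))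

  subTail-on : ∀ {x} → OnEdge x → subTail e (end x) ≡ source
  subTail-on {x} (inj₁ p) rewrite dec-true (x ≟ e) p = ≡.refl
  subTail-on {x} (inj₂ p) rewrite dec-true (x ≟ rev e) p | Bool.∨-zeroʳ (does (x ≟ e)) = ≡.refl

  subTail-off : ∀ {x} → ¬ OnEdge x → subTail e (end x) ≡ vertex (tail x)
  subTail-off {x} off rewrite dec-false (x ≟ e) (off ∘ inj₁) | dec-false (x ≟ rev e) (off ∘ inj₂) = ≡.refl

  subWeight-e : ∀ t → subWeight e t (end e) ≡ (1# - t) * w e
  subWeight-e t rewrite dec-true (e ≟ e) ≡.refl = ≡.refl

  subWeight-rev : ∀ t → subWeight e t (end (rev e)) ≡ t * w (rev e)
  subWeight-rev t rewrite dec-false (rev e ≟ e) rev≢ | dec-true (rev e ≟ rev e) ≡.refl = ≡.refl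

  subWeight-off : ∀ t {x} → ¬ OnEdge x → subWeight e t (end x) ≡ w x
  subWeight-off t {x} off rewrite dec-false (x ≟ e) (off ∘ inj₁) | dec-false (x ≟ rev e) (off ∘ inj₂) = ≡.refl

  weight-∷ʳ : ∀ xs x → weight (xs ∷ʳ x) ≈ weight xs + w x
  weight-∷ʳ []       x = +-comm (w x) 0#
  weight-∷ʳ (y ∷ xs) x = trans (+-congˡ (weight-∷ʳ xs x)) (sym (+-assoc (w y) (weight xs) (w x)))

  weight-off : ∀ t {xs} → All (¬_ ∘ OnEdge) xs → weightᴿ t (map end xs) ≡ weight xs
  weight-off t []         = ≡.refl
  weight-off t (off ∷ xs) = ≡.cong₂ _+_ (subWeight-off t off) (weight-off t xs)

  subWeight-nonNegative : ∀ {t} → 0# ≤ t → t ≤ 1# → ∀ x → 0# ≤ subWeight e t x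
  subWeight-nonNegative {t} 0≤t t≤1 (end x) with does (x ≟ e) | does (x ≟ rev e)
  ... | true  | _     = *-nonNegative (1-nonNegative t≤1) (nonNegative x)
  ... | false | true  = *-nonNegative 0≤t (nonNegative x)
  ... | false | false = nonNegative x
  subWeight-nonNegative 0≤t t≤1 start  = *-nonNegative 0≤t (nonNegative e)
  subWeight-nonNegative 0≤t t≤1 startʳ = *-nonNegative (1-nonNegative t≤1) (nonNegative (rev e))

  weight-nonNegative : ∀ {t} → 0# ≤ t → t ≤ 1# → ∀ xs → 0# ≤ weightᴿ t xs
  weight-nonNegative 0≤t t≤1 []       = inj₂ refl
  weight-nonNegative 0≤t t≤1 (x ∷ xs) =
    +-nonNegative (subWeight-nonNegative 0≤t t≤1 x) (weight-nonNegative 0≤t t≤1 xs)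

  dist-self : ∀ {t} → 0# ≤ t → t ≤ 1# → ∀ v → At.IsDist e t v v 0#
  dist-self 0≤t t≤1 v = [] , (≡.refl , λ ys _ → weight-nonNegative 0≤t t≤1 ys) , refl

  dist-unique : ∀ {t u v δ δ′} → At.IsDist e t u v δ → At.IsDist e t u v δ′ → δ ≈ δ′
  dist-unique (xs , (p , least) , eq) (ys , (p′ , least′) , eq′) =
    trans (sym eq) (trans (≤-antisym (least ys p′) (least′ xs p)) eq′)

  isWalk-∷ʳ : ∀ {u} xs {x} → IsWalk u xs (tail x) → IsWalk u (xs ∷ʳ x) (head x)
  isWalk-∷ʳ []       eq       = ≡.sym eq , ≡.refl
  isWalk-∷ʳ (y ∷ xs) (eq , p) = eq , isWalk-∷ʳ xs p

  -- A passage through the subdivided edge becomes a passage through the source, whose two parts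
  -- have the same total weight by `partition`.
  subdivide : ∀ t {u v} xs → IsWalk u xs v →
              ∃ λ ys → Walkᴿ (vertex u) ys (vertex v) × weightᴿ t ys ≈ weight xs
  subdivide t []       ≡.refl         = [] , ≡.refl , refl
  subdivide t (x ∷ xs) (≡.refl , p) with subdivide t xs p | x ≟ e | x ≟ rev e
  ... | ys , p′ , eq | yes ≡.refl | _ =
    start ∷ end e ∷ ys , (≡.refl , subTail-on (inj₁ ≡.refl) , p′) ,
    trans (sym (+-assoc _ _ _)) (+-cong (trans (+-congˡ (reflexive (subWeight-e t))) (partition t (w e))) eq)
  ... | ys , p′ , eq | no _ | yes ≡.refl =
    startʳ ∷ end (rev e) ∷ ys , (≡.refl , subTail-on (inj₂ ≡.refl) , p′) ,
    trans (sym (+-assoc _ _ _)) (+-cong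
      (trans (+-congˡ (reflexive (subWeight-rev t))) (trans (+-comm _ _) (partition t (w (rev e))))) eq)
  ... | ys , p′ , eq | no x≢e | no x≢rev =
    end x ∷ ys , (subTail-off off , p′) , +-cong (reflexive (subWeight-off t off)) eq
    where
    off : ¬ OnEdge x
    off = [ x≢e , x≢rev ]′

  -- A lighter walk in `G` from `head a` could be subdivided and prefixed with the half `a`, giving
  -- a walk from the source that violates `least`.
  shortest-rest : ∀ t {a xs v} → OnEdge a → IsWalk (head a) xs v →
    (∀ ys → Walkᴿ source ys (vertex v) → subWeight e t (end a) + weight xs ≤ weightᴿ t ys) →
    IsShortestWalk (head a) xs v
  shortest-rest t {a} {xs} on p least = p , λ ys q →
    let zs , q′ , eq = subdivide t ys q
    in +-cancelˡ-≤ (subWeight e t (end a))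
         (≤-trans (least (end a ∷ zs) (subTail-on on , q′)) (inj₂ (+-congˡ eq)))

  module Trees (T : Vertex → Dart) (enters : ∀ v → head (T v) ≡ v) where

    -- The tree path to z enters G through the half a of the subdivided edge
    -- and continues along the darts of the list.
    data TreePath (z : Vertex) : Dart → List Dart → Set where
      root : OnEdge (T z) → TreePath z (T z) []
      step : ∀ {a ys} → ¬ OnEdge (T z) → TreePath (tail (T z)) a ys → TreePath z a (ys ∷ʳ T z)

    path-unique : ∀ {z a ys a′ ys′} → TreePath z a ys → TreePath z a′ ys′ → a ≡ a′ × ys ≡ ys′
    path-unique (root _)     (root _)     = ≡.refl , ≡.refl
    path-unique (root on)    (step off _) = contradiction on off
    path-unique (step off _) (root on)    = contradiction on off
    path-unique (step _ p)   (step _ p′)  =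
      let eq , eq′ = path-unique p p′ in eq , ≡.cong (_∷ʳ T _) eq′

    path-onEdge : ∀ {z a ys} → TreePath z a ys → OnEdge a
    path-onEdge (root on)  = on
    path-onEdge (step _ p) = path-onEdge p

    path-off : ∀ {z a ys} → TreePath z a ys → All (¬_ ∘ OnEdge) ys
    path-off (root _)     = []
    path-off (step off p) = All.∷ʳ⁺ (path-off p) off

    path-walk : ∀ {z a ys} → TreePath z a ys → IsWalk (head a) ys z
    path-walk {z} (root _)            = enters z
    path-walk {z} {a} (step {ys = ys} _ p) =
      ≡.subst (IsWalk (head a) (ys ∷ʳ T z)) (enters z) (isWalk-∷ʳ ys (path-walk p))

    path-ends : ∀ {z a ys} → TreePath z a ys → ∃ λ zs → a ∷ ys ≡ zs ∷ʳ T z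
    path-ends (root _)                   = [] , ≡.refl
    path-ends {a = a} (step {ys = ys} _ _) = a ∷ ys , ≡.refl

    -- The part of a tree path up to a vertex on it is the tree path of that vertex. The bound on
    -- the length serves to exclude repeated vertices.
    path-visits : ∀ {z a ys v} → TreePath z a ys → v ∈ map head (a ∷ ys) →
                  ∃ λ zs → TreePath v a zs × length zs ℕ.≤ length ys
    path-visits {z} {v = v} (root on) (here eq) =
      [] , ≡.subst (λ u → TreePath u (T z) []) (≡.sym (≡.trans eq (enters z))) (root on) , z≤n
    path-visits {z} {a} {v = v} p@(step {ys = ys} off q) v∈
      with ∈-++⁻ (map head (a ∷ ys)) (≡.subst (v ∈_) (List.map-++ head (a ∷ ys) (T z ∷ [])) v∈)
    ... | inj₁ v∈′ = let zs , q′ , le = path-visits q v∈′ in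
      zs , q′ , ℕ.≤-trans le (≡.subst (length ys ℕ.≤_) (≡.sym (List.length-++ ys)) (ℕ.m≤m+n _ 1))
    ... | inj₂ (here eq) =
      ys ∷ʳ T z , ≡.subst (λ u → TreePath u a (ys ∷ʳ T z)) (≡.sym (≡.trans eq (enters z))) p , ℕ.≤-refl

    -- If `z` already occurred on the path to its parent, it would have a tree path no longer than
    -- that one, although its unique tree path is longer by one dart.
    path-simple : ∀ {z a ys} → TreePath z a ys → IsSimple (head a) ys
    path-simple (root _) = [] ∷ []
    path-simple {z} {a} p@(step {ys = ys} _ q) =
      ≡.subst Unique (≡.sym (List.map-++ head (a ∷ ys) (T z ∷ [])))
        (unique-∷ʳ (path-simple q) fresh)
      where
      fresh : head (T z) ∉ map head (a ∷ ys)
      fresh z∈ = let zs , p′ , le = path-visits q (≡.subst (_∈ map head (a ∷ ys)) (enters z) z∈) in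
        ℕ.<⇒≱ (≡.subst (length ys ℕ.<_) (≡.sym (≡.trans (List.length-++ ys) (ℕ.+-comm (length ys) 1))) (ℕ.n<1+n _))
              (≡.subst (λ ys′ → length ys′ ℕ.≤ length ys) (proj₂ (path-unique p′ p)) le)

    IsTreeWalk : List SubDart → Set
    IsTreeWalk = All (λ x → ∃[ u ] x ≡ end (T u))

    -- A tree dart on the subdivided edge starts at the source, and no dart `end x` leads back
    -- there. Hence a tree walk that has reached a vertex of `G` stays off that edge.
    path-extend : ∀ {u z a ys xs} → TreePath u a ys → Walkᴿ (vertex u) xs (vertex z) →
                  IsTreeWalk xs → ∃ λ zs → xs ≡ map end zs × TreePath z a (ys ++ zs)
    path-extend {ys = ys} {[]} p ≡.refl [] =
      [] , ≡.refl , ≡.subst (TreePath _ _) (≡.sym (List.++-identityʳ ys)) p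
    path-extend {u} {z} {a} {ys} {_ ∷ xs} p (at , q) ((v , ≡.refl) ∷ tree) with onEdge? (T v)
    ... | yes on = case ≡.trans (≡.sym (subTail-on on)) at of λ ()
    ... | no off with ≡.refl ← ≡.trans (≡.sym (subTail-off off)) at =
      let zs , eq , p′ = path-extend (step off p)
            (≡.subst (λ v → Walkᴿ (vertex v) xs (vertex z)) (enters v) q) tree
      in T v ∷ zs , ≡.cong (end (T v) ∷_) eq , ≡.subst (TreePath z a) (List.∷ʳ-++ ys (T v) zs) p′

    path-from-source : ∀ {z xs} → Walkᴿ source xs (vertex z) → IsTreeWalk xs →
                       ∃ λ a → ∃ λ ys → xs ≡ map end (a ∷ ys) × TreePath z a ys
    path-from-source {z} {_ ∷ xs} (at , q) ((v , ≡.refl) ∷ tree) with onEdge? (T v)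
    ... | no off = case ≡.trans (≡.sym (subTail-off off)) at of λ ()
    ... | yes on =
      let zs , eq , p = path-extend (root on)
            (≡.subst (λ v → Walkᴿ (vertex v) xs (vertex z)) (enters v) q) tree
      in T v , zs , ≡.cong (end (T v) ∷_) eq , p

  -- A pivot expressed in `G` alone: the old path to `head y` leaves through `tail e` and ends in
  -- `x`, the new one leaves through `head e` and ends in `y`. The darts `rev e` and `e` are
  -- prefixed since the last dart may be the half edge itself, followed by an empty path.
  record Exchange (t : Carrier) (y x : Dart) : Set (c ⊔ ℓ₁ ⊔ ℓ₂) where
    field
      after before : List Dart
      after-path   : IsShortestPath (head e) after (head y)
      before-path  : IsShortestPath (tail e) before (head y)
      after-ends   : ∃ λ zs → e ∷ after ≡ zs ∷ʳ y
      before-ends  : ∃ λ zs → rev e ∷ before ≡ zs ∷ʳ x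
      same-head    : head x ≡ head y
      distinct     : y ≢ x
      balanced     : (1# - t) * w e + weight after ≈ t * w (rev e) + weight before
      positive     : 0# < w e ⊎ 0# < w (rev e)

  module _ {t y x} (pivot : Pivot e t y x) where
    open Pivot pivot

    z : Vertex
    z = head y

    open Trees T (IsShortestPathTree.enters (isTree r (inj₂ refl) (inj₁ r<t)))

    InRange : Carrier → Set (ℓ₁ ⊔ ℓ₂)
    InRange q = r ≤ q × q ≤ t

    r∈ : InRange r
    r∈ = inj₂ refl , inj₁ r<t

    t∈ : InRange t
    t∈ = inj₁ r<t , inj₂ refl

    -- The tree `T` is the same at all times from `r` to `t` and determines the path to `v`, so a
    -- single list of darts is shortest throughout.
    tree-path : ∀ v → ∃ λ a → ∃ λ ys → TreePath v a ys ×
      (∀ {q} → InRange q → At.IsShortestWalk e q source (map end (a ∷ ys)) (vertex v))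
    tree-path v with IsShortestPathTree.shortest (isTree t (proj₁ t∈) (proj₂ t∈)) v
    ... | xs , (p , _) , tree with path-from-source p tree
    ... | a , ys , _ , path = a , ys , path , least
      where
      least : ∀ {q} → InRange q → At.IsShortestWalk e q source (map end (a ∷ ys)) (vertex v)
      least {q} (r≤q , q≤t) with IsShortestPathTree.shortest (isTree q r≤q q≤t) v
      ... | xs′ , short , tree′ with path-from-source (proj₁ short) tree′
      ... | a′ , ys′ , ≡.refl , path′ with path-unique path′ path
      ... | ≡.refl , ≡.refl = short

    -- The candidate path to `z` whose last dart is `y`. It is simple unless the tree path to
    -- `tail y` visits `z`, and then the tree path to `z` would start with the same half `a`; hence
    -- the premise of `simple`.
    record Approach (a : Dart) (ys : List Dart) : Set (c ⊔ ℓ₁ ⊔ ℓ₂) where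
      field
        onEdge : OnEdge a
        walk   : IsWalk (head a) ys z
        ends   : ∃ λ zs → a ∷ ys ≡ zs ∷ʳ y
        simple : (∀ {zs} → ¬ TreePath z a zs) → IsSimple (head a) ys
        dist   : ∀ {q} → InRange q → ∃ λ δ → At.IsDist e q source (subTail e (end y)) δ ×
                 δ + subWeight e q (end y) ≈ subWeight e q (end a) + weight ys

    approach : ∃ λ a → ∃ λ ys → Approach a ys
    approach with onEdge? y
    -- In the subdivision `y` now starts at the source itself, at distance zero.
    ... | yes on = y , [] , record
      { onEdge = on
      ; walk   = ≡.refl
      ; ends   = [] , ≡.refl
      ; simple = λ _ → [] ∷ []
      ; dist   = λ {q} (r≤q , q≤t) → 0# ,
          ≡.subst (λ v → At.IsDist e q source v 0#) (≡.sym (subTail-on on))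
            (dist-self (≤-trans 0≤r r≤q) (≤-trans q≤t t≤1) source) ,
          +-comm 0# _
      }
    ... | no off =
      let a , ys , path , least = tree-path (tail y) in
      a , ys ∷ʳ y , record
      { onEdge = path-onEdge path
      ; walk   = isWalk-∷ʳ ys (path-walk path)
      ; ends   = a ∷ ys , ≡.refl
      ; simple = λ none → ≡.subst Unique (≡.sym (List.map-++ head (a ∷ ys) (y ∷ [])))
          (unique-∷ʳ (path-simple path) λ z∈ →
            let zs , path′ , _ = path-visits path z∈ in none path′)
      ; dist   = λ {q} q∈ → weightᴿ q (map end (a ∷ ys)) ,
          ≡.subst (λ v → At.IsDist e q source v (weightᴿ q (map end (a ∷ ys)))) (≡.sym (subTail-off off))
            (map end (a ∷ ys) , least q∈ , refl) ,
          trans (+-assoc _ _ _) (+-congˡ (trans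
            (+-cong (reflexive (weight-off q (path-off path))) (reflexive (subWeight-off q off)))
            (sym (weight-∷ʳ ys y))))
      }

    module _ {a ys b zs} (via-y : Approach a ys) (via-x : TreePath z b zs)
             (least : ∀ {q} → InRange q → At.IsShortestWalk e q source (map end (b ∷ zs)) (vertex z))
             where
      open Approach via-y

      slack : Carrier → Carrier
      slack q = (subWeight e q (end a) + weight ys) - (subWeight e q (end b) + weight zs)

      dist-z : ∀ {q} → InRange q →
               At.IsDist e q source (vertex z) (subWeight e q (end b) + weight zs)
      dist-z {q} q∈ = map end (b ∷ zs) , least q∈ , +-congˡ (reflexive (weight-off q (path-off via-x)))

      slack-correct : ∀ {q} → InRange q → Slack e q y (slack q)
      slack-correct q∈ = let δ , isDist , eq = dist q∈ in
        δ , _ , isDist , dist-z q∈ , +-congʳ (sym eq)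

      slack-falls : subWeight e t (end a) + subWeight e r (end b) <
                    subWeight e r (end a) + subWeight e t (end b)
      slack-falls = crossed-difference
        (decreasing (inj₂ refl) r<t (inj₂ refl) (slack-correct r∈) (slack-correct t∈))

      tight : subWeight e t (end a) + weight ys ≈ subWeight e t (end b) + weight zs
      tight with vanishes
      ... | δ , δ′ , isDist , isDist′ , eq = let _ , isDist″ , eq′ = dist t∈ in
        trans (sym eq′) (trans (+-congʳ (dist-unique isDist″ isDist))
          (trans (x-y≈0⇒x≈y (sym eq)) (dist-unique isDist′ (dist-z t∈))))

      least-z : ∀ us → Walkᴿ source us (vertex z) →
                subWeight e t (end b) + weight zs ≤ weightᴿ t us
      least-z us p = ≤-trans
        (inj₂ (sym (+-congˡ (reflexive (weight-off t (path-off via-x))))))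
        (proj₂ (least t∈) us p)

    -- The slack of `y` varies only through the two halves with which the competing paths start. Of
    -- the four combinations, only the new path through `e` and the old one through `rev e` lets it
    -- decrease.
    exchange : Exchange t y x
    exchange with approach | tree-path z
    ... | a , ys , via-y | b , zs , via-x , least
      with Approach.onEdge via-y | path-onEdge via-x | slack-falls via-y via-x least
         | tight via-y via-x least | least-z via-y via-x least
    ... | inj₁ ≡.refl | inj₁ ≡.refl | falls | _ | _ = contradiction falls (<-irrefl (+-comm _ _))
    ... | inj₂ ≡.refl | inj₂ ≡.refl | falls | _ | _ = contradiction falls (<-irrefl (+-comm _ _))
    -- Here the path through `y` does not get lighter and the tree path does not get heavier, so the
    -- slack cannot fall.
    ... | inj₂ ≡.refl | inj₁ ≡.refl | falls | _ | _ =
      contradiction (+-mono-≤ (*-monoˡ-≤ (nonNegative (rev e)) (inj₁ r<t))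
                              (*-monoˡ-≤ (nonNegative e) (1-anti-≤ (inj₁ r<t))))
        (<⇒≱ (≡.subst₂ _<_
          (≡.cong₂ _+_ (subWeight-rev t) (subWeight-e r))
          (≡.cong₂ _+_ (subWeight-rev r) (subWeight-e t)) falls))
    ... | inj₁ ≡.refl | inj₂ ≡.refl | falls | eq | least-z = record
      { after       = ys
      ; before      = zs
      -- The tree path to `z` starts with `rev e`, so by uniqueness none starts with `e`.
      ; after-path  = simple (λ path → rev≢ (proj₁ (path-unique via-x path))) ,
                      shortest-rest t (inj₁ ≡.refl) walk λ us p → ≤-trans (inj₂ eq) (least-z us p)
      ; before-path = ≡.subst (λ u → IsShortestPath u zs z) (≡.cong tail (rev-involutive e))
                        (path-simple via-x , shortest-rest t (inj₂ ≡.refl) (path-walk via-x) least-z)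
      ; after-ends  = ends
      ; before-ends = let us , p = path-ends via-x in us , ≡.trans p (≡.cong (us ∷ʳ_) replaced)
      ; same-head   = ≡.trans (≡.cong head (≡.sym replaced))
                        (IsShortestPathTree.enters (isTree r (proj₁ r∈) (proj₂ r∈)) z)
      ; distinct    = λ y≡x → nontree (≡.trans replaced (≡.sym y≡x))
      ; balanced    = ≡.subst₂ _≈_ (≡.cong (_+ weight ys) (subWeight-e t))
                        (≡.cong (_+ weight zs) (subWeight-rev t)) eq
      ; positive    = positive
      }
      where
      open Approach via-y

      falls′ : (1# - t) * w e + r * w (rev e) < (1# - r) * w e + t * w (rev e)
      falls′ = ≡.subst₂ _<_
        (≡.cong₂ _+_ (subWeight-e t) (subWeight-rev r))
        (≡.cong₂ _+_ (subWeight-e r) (subWeight-rev t)) falls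

      vanish : ∀ {v} → 0# ≈ v → ∀ s → s * v ≈ 0#
      vanish eq s = trans (*-congˡ (sym eq)) (zeroʳ s)

      -- If both darts of the edge had weight zero, moving the source would not change the slack.
      positive : 0# < w e ⊎ 0# < w (rev e)
      positive with nonNegative e | nonNegative (rev e)
      ... | inj₁ 0<we | _         = inj₁ 0<we
      ... | inj₂ _    | inj₁ 0<wr = inj₂ 0<wr
      ... | inj₂ 0≈we | inj₂ 0≈wr = contradiction falls′ (<-irrefl (+-cong
        (trans (vanish 0≈we _) (sym (vanish 0≈we _)))
        (trans (vanish 0≈wr _) (sym (vanish 0≈wr _)))))

∷≡∷ʳ⇒≡∷ʳ : ∀ {a} {A : Set a} {x y : A} {xs zs} → x ∷ xs ≡ zs ∷ʳ y → x ≢ y →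
           ∃ λ ys → xs ≡ ys ∷ʳ y
∷≡∷ʳ⇒≡∷ʳ {zs = []}     eq x≢y = contradiction (List.∷-injectiveˡ eq) x≢y
∷≡∷ʳ⇒≡∷ʳ {zs = _ ∷ zs} eq x≢y = zs , List.∷-injectiveʳ eq

∷≡∷ʳ⇒≢∷ʳ : ∀ {a} {A : Set a} {x y z : A} {xs zs} → x ∷ xs ≡ zs ∷ʳ y → z ≢ y →
           ∀ ys → xs ≢ ys ∷ʳ z
∷≡∷ʳ⇒≢∷ʳ {x = x} {zs = zs} eq z≢y ys ≡.refl = z≢y (List.∷ʳ-injectiveʳ (x ∷ ys) zs eq)

-- The branch of shortest paths behind a dart, and its boundary on a face.

module ShortestPaths {c ℓ₁ ℓ₂} (K : OrderedField c ℓ₁ ℓ₂) {g : ℕ} (G : CellularEmbedding g)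
                     (w : CellularEmbedding.Dart G → OrderedField.Carrier K) where
  open OrderedFieldProperties K
  open CellularEmbedding G
  open Weighted K w
  open EmbeddingHomology G using (rev-involutive)
  open FaceCrossings G
  open import Data.Nat using (_*_; _≤_)

  shortest-tail : ∀ {u x xs v} → IsShortestPath u (x ∷ xs) v → IsShortestPath (head x) xs v
  shortest-tail {x = x} (_ ∷ simple , (at , p) , least) =
    simple , p , λ ys q → +-cancelˡ-≤ (w x) (least (x ∷ ys) (at , q))

  isWalk-∷ʳ⁻ : ∀ {u} xs {x v} → IsWalk u (xs ∷ʳ x) v → IsWalk u xs (tail x)
  isWalk-∷ʳ⁻ []       (at , _) = ≡.sym at
  isWalk-∷ʳ⁻ (_ ∷ xs) (at , p) = at , isWalk-∷ʳ⁻ xs p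

  module _ {colour : Vertex → Bool} {b : Bool} where

    connected-sym : ∀ {u v} → Connected colour b u v → Connected colour b v u
    connected-sym = reverse λ { (x , (p , q) , r , s) →
      rev x , (q , ≡.trans (≡.cong tail (rev-involutive x)) p) , s , r }

    walk-connected : ∀ {u xs v} → IsWalk u xs v →
                     All (λ v → colour v ≡ b) (u ∷ map head xs) → Connected colour b u v
    walk-connected {xs = []}     ≡.refl      _            = ε
    walk-connected {xs = x ∷ xs} (at , p) (q ∷ qs@(r ∷ _)) =
      (x , (at , ≡.refl) , q , r) ◅ walk-connected p qs

  module _ (d : Dart)
           (uniquePath : ∀ {u xs ys} → IsShortestPath u xs (head d) →
                         IsShortestPath u ys (head d) → xs ≡ ys) where

    Through Around : Vertex → Set (ℓ₁ ⊔ ℓ₂)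
    Through u = ∃ λ xs → IsShortestPath u (xs ∷ʳ d) (head d)
    Around  u = ∃ λ xs → IsShortestPath u xs (head d) × (∀ ys → xs ≢ ys ∷ʳ d)

    -- Suffixes of shortest paths are shortest, so the branch contains every vertex that such a path
    -- visits before `d`.
    through-path : ∀ {u} xs → IsShortestPath u (xs ∷ʳ d) (head d) → All Through (u ∷ map head xs)
    through-path []       short = ([] , short) ∷ []
    through-path (x ∷ xs) short = (x ∷ xs , short) ∷ through-path xs (shortest-tail short)

    around-path : ∀ {u} xs → IsShortestPath u xs (head d) → (∀ ys → xs ≢ ys ∷ʳ d) →
                  All Around (u ∷ map head xs)
    around-path []       short not-d = ([] , short , not-d) ∷ []
    around-path (x ∷ xs) short not-d =
      (x ∷ xs , short , not-d) ∷
      around-path xs (shortest-tail short) λ ys eq → not-d (x ∷ ys) (≡.cong (x ∷_) eq)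

    disjoint : ∀ {u} → Through u → ¬ Around u
    disjoint (xs , short) (ys , short′ , not-d) = not-d xs (uniquePath short′ short)

    -- Colouring by membership in this finite list avoids having to decide `Through`. The list holds
    -- whole paths up to `tail d`, so it is still connected.
    visited : ∀ {us} → All Through us → List Vertex
    visited []                     = []
    visited (_∷_ {x = u} (xs , _) ts) = (u ∷ map head xs) ++ visited ts

    visited-through : ∀ {us} (ts : All Through us) → All Through (visited ts)
    visited-through []                = []
    visited-through ((xs , short) ∷ ts) = All.++⁺ (through-path xs short) (visited-through ts)

    visited-path : ∀ {us} (ts : All Through us) {u} → u ∈ us →
                   ∃ λ xs → IsWalk u xs (tail d) × All (_∈ visited ts) (u ∷ map head xs)
    visited-path ((xs , short) ∷ ts) (here ≡.refl) =
      xs , isWalk-∷ʳ⁻ xs (proj₁ (proj₂ short)) , All.tabulate ∈-++⁺ˡ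
    visited-path (_∷_ {x = u} (xs , _) ts) (there u∈) =
      let ys , p , vs = visited-path ts u∈
      in ys , p , All.map (∈-++⁺ʳ (u ∷ map head xs)) vs

    -- The branch receives the colour `b`. The listed vertices of the branch are joined through
    -- `tail d`, those around it through `head d`; by `disjoint` the paths of the second kind avoid
    -- the first colour.
    module Separation (b : Bool) {us vs} (ts : All Through us) (as : All Around vs) where

      colour : Vertex → Bool
      colour v = if does (any? (v Fin.≟_) (visited ts)) then b else not b

      colour-∈ : ∀ {v} → v ∈ visited ts → colour v ≡ b
      colour-∈ {v} v∈ = ≡.cong (if_then b else not b) (dec-true (any? (v Fin.≟_) (visited ts)) v∈)

      colour-around : ∀ {v} → Around v → colour v ≡ not b
      colour-around {v} a = ≡.cong (if_then b else not b)
        (dec-false (any? (v Fin.≟_) (visited ts)) λ v∈ →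
          disjoint (All.lookup (visited-through ts) v∈) a)

      through-colour : ∀ {u} → u ∈ us → colour u ≡ b
      through-colour u∈ with _ , _ , u∈′ ∷ _ ← visited-path ts u∈ = colour-∈ u∈′

      around-colour : ∀ {v} → v ∈ vs → colour v ≡ not b
      around-colour v∈ = colour-around (All.lookup as v∈)

      through-connected : ∀ {u u′} → u ∈ us → u′ ∈ us → Connected colour b u u′
      through-connected u∈ u′∈ = toTail u∈ ◅◅ connected-sym (toTail u′∈)
        where
        toTail : ∀ {u} → u ∈ us → Connected colour b u (tail d)
        toTail u∈ = let _ , p , vs = visited-path ts u∈ in walk-connected p (All.map colour-∈ vs)

      around-connected : ∀ {v v′} → v ∈ vs → v′ ∈ vs → Connected colour (not b) v v′
      around-connected v∈ v′∈ = toHead v∈ ◅◅ connected-sym (toHead v′∈)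
        where
        toHead : ∀ {v} → v ∈ vs → Connected colour (not b) v (head d)
        toHead v∈ with xs , short , not-d ← All.lookup as v∈ =
          walk-connected (proj₁ (proj₂ short)) (All.map colour-around (around-path xs short not-d))

    Entering Leaving : Face → Dart → Set (ℓ₁ ⊔ ℓ₂)
    Entering f x = face x ≡ f × Through (head x) × Around (tail x)
    Leaving  f x = face x ≡ f × Through (tail x) × Around (head x)

    -- The additional one is the base crossing `x₀`, which yields no cycle.
    entering-bound : ∀ {f} xs → Unique xs → All (Entering f) xs → length xs ≤ suc (2 * g)
    entering-bound []        _ _    = z≤n
    entering-bound {f} (x₀ ∷ xs) u good = s≤s (crossings-bound crossings)
      where
      -- `Crossings` run from `false` to `true`, so a branch that is entered is coloured `true`, and
      -- below a branch that is left is coloured `false`.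
      open Separation true {us = map head (x₀ ∷ xs)} {vs = map tail (x₀ ∷ xs)}
        (All.map⁺ (All.map (proj₁ ∘ proj₂) good))
        (All.map⁺ (All.map (proj₂ ∘ proj₂) good))

      crossings : Crossings f colour x₀ xs
      crossings = record
        { unique     = u
        ; onFace     = proj₁ ∘ All.lookup good
        ; tail-false = around-colour ∘ ∈-map⁺ tail
        ; head-true  = through-colour ∘ ∈-map⁺ head
        ; tails      = λ x∈ → around-connected (∈-map⁺ tail x∈) (here ≡.refl)
        ; heads      = λ x∈ → through-connected (∈-map⁺ head x∈) (here ≡.refl)
        }

    leaving-bound : ∀ {f} xs → Unique xs → All (Leaving f) xs → length xs ≤ suc (2 * g)
    leaving-bound []        _ _    = z≤n
    leaving-bound {f} (x₀ ∷ xs) u good = s≤s (crossings-bound crossings)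
      where
      open Separation false {us = map tail (x₀ ∷ xs)} {vs = map head (x₀ ∷ xs)}
        (All.map⁺ (All.map (proj₁ ∘ proj₂) good))
        (All.map⁺ (All.map (proj₂ ∘ proj₂) good))

      crossings : Crossings f colour x₀ xs
      crossings = record
        { unique     = u
        ; onFace     = proj₁ ∘ All.lookup good
        ; tail-false = through-colour ∘ ∈-map⁺ tail
        ; head-true  = around-colour ∘ ∈-map⁺ head
        ; tails      = λ x∈ → through-connected (∈-map⁺ tail x∈) (here ≡.refl)
        ; heads      = λ x∈ → around-connected (∈-map⁺ head x∈) (here ≡.refl)
        }

-- Counting the positions at which a dart pivots.

module PivotCount {c ℓ₁ ℓ₂} (K : OrderedField c ℓ₁ ℓ₂) {g : ℕ} (1≤g : 1 ℕ.≤ g)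
                  (G : CellularEmbedding g)
                  (w : CellularEmbedding.Dart G → OrderedField.Carrier K)
                  (nonNegative : MovingSource.NonNegative K G w)
                  (f : CellularEmbedding.Face G) (generic : MovingSource.Generic K G w f) where
  open import Data.Nat using (_*_; _≤_)
  open OrderedField K hiding (_≤_) renaming (_*_ to _·_)
  open OrderedFieldProperties K
  open CellularEmbedding G
  open MovingSource K G w
  open Weighted K w
  open Generic generic
  open EmbeddingHomology G using (rev-involutive)
  open ShortestPaths K G w
  open SubdividedEdge K G w nonNegative using (Exchange; exchange)
  open UniqueSetoid (×-setoid (≡.setoid Dart) setoid) using () renaming (Unique to UniquePositions)

  -- The part of an `Exchange` that refers to the pivoting darts only through their common head; it
  -- suffices to determine the time.
  record Balance (z : Vertex) (e : Dart) (t : Carrier) : Set (c ⊔ ℓ₁ ⊔ ℓ₂) where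
    field
      after before : List Dart
      after-path   : IsShortestPath (head e) after z
      before-path  : IsShortestPath (tail e) before z
      balanced     : (1# - t) · w e + weight after ≈ t · w (rev e) + weight before
      positive     : 0# < w e ⊎ 0# < w (rev e)

  -- Both paths are determined by their ends, so the two times solve the same equation, which has at
  -- most one solution.
  balance-time : ∀ {z e s t} → Balance z e s → Balance z e t → s ≈ t
  balance-time {e = e} {t = t} p q = balance-unique (nonNegative e) (nonNegative (rev e)) P.positive P.balanced
    (≡.subst₂ (λ xs ys → (1# - t) · w e + weight xs ≈ t · w (rev e) + weight ys)
      (uniquePaths Q.after-path P.after-path) (uniquePaths Q.before-path P.before-path) Q.balanced)
    where
    module P = Balance p
    module Q = Balance q

  exchange-balance : ∀ {e t y x} → Exchange e t y x → Balance (head y) e t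
  exchange-balance {e} ex = record
    { after       = after
    ; before      = before
    ; after-path  = after-path
    ; before-path = before-path
    ; balanced    = balanced
    ; positive    = positive
    } where open Exchange e ex

  -- Two positions on the same dart would have the same time, so distinct positions lie on distinct
  -- darts and darts may be counted instead.
  unique-darts : ∀ {z ps} → UniquePositions ps → All (λ (e , t) → Balance z e t) ps →
                 Unique (map proj₁ ps)
  unique-darts []           []       = []
  unique-darts (p≢ps ∷ u) (b ∷ bs) =
    All.map⁺ (All.zipWith (λ { (p≢ , b′) ≡.refl → p≢ (≡.refl , balance-time b b′) }) (p≢ps , bs))
    ∷ unique-darts u bs

  without : Dart → List Dart → List Dart
  without x = filter λ y → ¬? (y ≟ x)

  without-length : ∀ x {xs} → Unique xs → length xs ≤ suc (length (without x xs))
  without-length x []                   = z≤n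
  without-length x {y ∷ xs} (y≢xs ∷ u) with y ≟ x
  ... | yes ≡.refl = s≤s (ℕ.≤-reflexive (≡.sym (≡.cong length
                       (List.filter-all (λ y → ¬? (y ≟ x)) (All.map (_∘ ≡.sym) y≢xs)))))
  ... | no  y≢x    = s≤s (without-length x u)

  -- The exceptional dart `bad` accounts for at most one position. The others number at most 1 + 2g,
  -- and the total 2 + 2g is at most 4g because g ≥ 1.
  positions-bound : ∀ {ℓ z ps} {P : Dart → Set ℓ} bad → UniquePositions ps →
    All (λ (e , t) → Balance z e t × (e ≢ bad → P e)) ps →
    (∀ xs → Unique xs → All P xs → length xs ≤ suc (2 * g)) →
    length ps ≤ 4 * g
  positions-bound {ps = ps} {P} bad u good bound = begin
    length ps                    ≡⟨ List.length-map proj₁ ps ⟨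
    length es                    ≤⟨ without-length bad unique ⟩
    suc (length (without bad es)) ≤⟨ s≤s (bound _ (Unique.filter⁺ _ unique) kept) ⟩
    2 ℕ.+ 2 * g                  ≤⟨ ℕ.+-monoˡ-≤ (2 * g) (ℕ.*-monoʳ-≤ 2 1≤g) ⟩
    2 * g ℕ.+ 2 * g              ≡⟨ ℕ.*-distribʳ-+ g 2 2 ⟨
    4 * g                        ∎
    where
    open ℕ.≤-Reasoning
    es = map proj₁ ps

    unique : Unique es
    unique = unique-darts u (All.map proj₁ good)

    kept : All P (without bad es)
    kept = All.zipWith (λ (keep , e≢bad) → keep e≢bad)
      ( All.filter⁺ _ (All.map⁺ (All.map proj₂ good))
      , All.all-filter (λ y → ¬? (y ≟ bad)) es)

  -- The exceptional dart is `y` itself: while the source runs along it, `y` may be the half edge in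
  -- front of `after` rather than the last dart of that path.
  pivotsIn-bound : ∀ y → HappensAtMost (4 * g) f (λ e t → PivotsIn e t y)
  pivotsIn-bound y ps u good =
    positions-bound y u (All.map split good) (entering-bound y uniquePaths)
    where
    split : ∀ {p} → face (proj₁ p) ≡ f × PivotsIn (proj₁ p) (proj₂ p) y →
            Balance (head y) (proj₁ p) (proj₂ p) ×
            (proj₁ p ≢ y → Entering y uniquePaths f (proj₁ p))
    split {e , t} (onFace , x , pivot) = exchange-balance ex , λ e≢y →
      let xs , eq = ∷≡∷ʳ⇒≡∷ʳ (proj₂ after-ends) e≢y in
      onFace ,
      (xs , ≡.subst (λ ys → IsShortestPath (head e) ys (head y)) eq after-path) ,
      (before , before-path , ∷≡∷ʳ⇒≢∷ʳ (proj₂ before-ends) distinct)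
      where
      ex = exchange e pivot
      open Exchange e ex

  -- The old path starts with the half `rev e`, so the exception arises when `rev e` is `x`, that
  -- is, when the source runs along `rev x`.
  pivotsOut-bound : ∀ x → HappensAtMost (4 * g) f (λ e t → PivotsOut e t x)
  pivotsOut-bound x ps u good =
    positions-bound (rev x) u (All.map split good) (leaving-bound x uniquePaths)
    where
    split : ∀ {p} → face (proj₁ p) ≡ f × PivotsOut (proj₁ p) (proj₂ p) x →
            Balance (head x) (proj₁ p) (proj₂ p) ×
            (proj₁ p ≢ rev x → Leaving x uniquePaths f (proj₁ p))
    split {e , t} (onFace , y , pivot) =
      ≡.subst (λ z → Balance z e t) (≡.sym same-head) (exchange-balance ex) , λ e≢rev →
      let xs , eq = ∷≡∷ʳ⇒≡∷ʳ (proj₂ before-ends)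
                      (λ rev≡ → e≢rev (≡.trans (≡.sym (rev-involutive e)) (≡.cong rev rev≡))) in
      onFace ,
      (xs , ≡.subst₂ (IsShortestPath (tail e)) eq (≡.sym same-head) before-path) ,
      (after , ≡.subst (IsShortestPath (head e) after) (≡.sym same-head) after-path ,
       ∷≡∷ʳ⇒≢∷ʳ (proj₂ after-ends) (distinct ∘ ≡.sym))
      where
      ex = exchange e pivot
      open Exchange e ex

open import Data.Nat using (_*_; _≤_)

lemma4p3 : ∀ {c ℓ₁ ℓ₂} → ∃ λ (C : ℕ) →
    (K : OrderedField c ℓ₁ ℓ₂) (g : ℕ) → 1 ≤ g →
    (G : CellularEmbedding g) (w : CellularEmbedding.Dart G → OrderedField.Carrier K) →
    MovingSource.NonNegative K G w →
    (f : CellularEmbedding.Face G) → MovingSource.Generic K G w f →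
    (x : CellularEmbedding.Dart G) →
    MovingSource.HappensAtMost K G w (C * g) f (λ e t → MovingSource.PivotsIn K G w e t x)
    × MovingSource.HappensAtMost K G w (C * g) f (λ e t → MovingSource.PivotsOut K G w e t x)
lemma4p3 = 4 , λ K g 1≤g G w nonNegative f generic x →
  let open PivotCount K 1≤g G w nonNegative f generic
  in pivotsIn-bound x , pivotsOut-bound x
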